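{- Let $h\ge 1$ be an integer and let $P\subset\mathbb R^2$ be a minimal lattice polygon with $\operatorname{ls}_\square(P)=h$. Then $P$ is lattice-equivalent to one of the following: (a) the segment $[(0,0),(h,0)]$; (b) a triangle $\operatorname{conv}\{(0,0),(a,h),(h,b)\}$ with integers $a,b\in[1,h-1]$ and $a+b\ge h$; (c) a quadrilateral $\operatorname{conv}\{(a,0),(0,b),(h,h-c),(h-d,h)\}$ with integers $a,b,c,d\in[1,h-1]$ and $\min\{a,b\}+\min\{c,d\}>h$.
   Context: A lattice polygon is a convex polygon (possibly degenerate, e.g. a segment) all of whose vertices lie in $\mathbb Z^2$. An affine unimodular transformation is $x\mapsto Ax+v$ with $A\in\mathbb Z^{2\times2}$, $\det A=\pm1$, $v\in\mathbb Z^2$; two sets are lattice-equivalent if one is the image of the other under such a map. With $\square=[0,1]^2$, $\operatorname{ls}_\square(P)$ is the smallest $l\ge0$ such that $\varphi(P)\subseteq l\square$ for some affine unimodular $\varphi$. A lattice polygon $P$ with $\operatorname{ls}_\square(P)=h$ is minimal if no lattice polygon properly contained in $P$ has $\operatorname{ls}_\square$ equal to $h$.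
   Formalization: The plane is taken to be Q² instead of R²: polygons are sets of rational points (convex hulls of lattice points with rational weights), and the dilation factor l in the lattice size ranges over the rational numbers l ≥ 0. -}

module Defs where

open import Algebra.Definitions.RawMonoid using (sum)
open import Data.Integer.Base as ℤ using (ℤ; 1ℤ; -1ℤ)
open import Data.Nat.Base using (suc)
open import Data.Product using (_×_; _,_; ∃; ∃-syntax; proj₁; proj₂)
open import Data.Rational.Base as ℚ using (ℚ; 0ℚ; 1ℚ; +-0-rawMonoid)
open import Data.Rational.Literals using (fromℤ)
open import Data.Sum.Base using (_⊎_)
open import Data.Vec.Functional using (Vector; map)
open import Level using (0ℓ)
open import Relation.Binary.PropositionalEquality using (_≡_)
open import Relation.Nullary using (¬_)
open import Relation.Unary using (Pred; _⊆_; _⊂_; _≐_)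

-- The plane is ℚ² rather than ℝ²: a lattice polygon is the closure of its
-- rational points, so inclusions, equalities and images under affine
-- unimodular maps can be read off from those points.

Point : Set
Point = ℚ × ℚ

LatticePoint : Set
LatticePoint = ℤ × ℤ

Region : Set₁
Region = Pred Point 0ℓ

ι : LatticePoint → Point
ι (x , y) = fromℤ x , fromℤ y

∑ : ∀ {n} → Vector ℚ n → ℚ
∑ = sum +-0-rawMonoid

-- The convex hull of finitely many lattice points, which need not be distinct
-- or in convex position.
conv : ∀ {n} → Vector LatticePoint n → Region
conv {n} V (x , y) = ∃ λ (t : Vector ℚ n) →
  (∀ i → 0ℚ ℚ.≤ t i) × ∑ t ≡ 1ℚ ×
  ∑ (λ i → t i ℚ.* proj₁ (ι (V i))) ≡ x ×
  ∑ (λ i → t i ℚ.* proj₂ (ι (V i))) ≡ y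

IsLatticePolygon : Region → Set
IsLatticePolygon P = ∃[ n ] ∃ λ (V : Vector LatticePoint (suc n)) → P ≐ conv V

-- x ↦ A x + v with A = (a₁₁ a₁₂ ; a₂₁ a₂₂) and v = (v₁ , v₂).
record AffineUnimodular : Set where
  field
    a₁₁ a₁₂ a₂₁ a₂₂ : ℤ
    v₁ v₂           : ℤ

  det : ℤ
  det = a₁₁ ℤ.* a₂₂ ℤ.- a₁₂ ℤ.* a₂₁

  field
    det≡±1 : det ≡ 1ℤ ⊎ det ≡ -1ℤ

  apply : Point → Point
  apply (x , y) =
    (fromℤ a₁₁ ℚ.* x ℚ.+ fromℤ a₁₂ ℚ.* y) ℚ.+ fromℤ v₁ ,
    (fromℤ a₂₁ ℚ.* x ℚ.+ fromℤ a₂₂ ℚ.* y) ℚ.+ fromℤ v₂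

open AffineUnimodular public using (apply)

image : AffineUnimodular → Region → Region
image φ P q = ∃[ p ] P p × apply φ p ≡ q

infix 4 _≃_

_≃_ : Region → Region → Set
P ≃ Q = ∃[ φ ] image φ P ≐ Q

-- The dilate l · [0,1]², for l ≥ 0.
_□ : ℚ → Region
(l □) (x , y) = (0ℚ ℚ.≤ x × x ℚ.≤ l) × (0ℚ ℚ.≤ y × y ℚ.≤ l)

FitsIn : Region → ℚ → Set
FitsIn P l = ∃[ φ ] image φ P ⊆ l □

-- HasLs P l says that ls□(P) = l.
HasLs : Region → ℚ → Set
HasLs P l =
  0ℚ ℚ.≤ l × FitsIn P l × (∀ l′ → 0ℚ ℚ.≤ l′ → FitsIn P l′ → l ℚ.≤ l′)

IsMinimal : Region → ℚ → Set₁
IsMinimal P l = IsLatticePolygon P × HasLs P l ×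
  (∀ Q → IsLatticePolygon Q → Q ⊂ P → ¬ HasLs Q l)

{-# OPTIONS --safe #-}

-- A lattice polygon has lattice size at least h precisely when every basis of
-- the dual lattice contains a direction of width at least h.  A polygon in the
-- box [0,h]² meeting all four sides has this property, because every basis
-- contains a direction (α,β) with |α| ≠ |β|.  So a minimal polygon meeting all
-- four sides is the convex hull of one lattice point on each side.  A polygon
-- that meets the left and right sides at (0,p) and (h,q) with q ≤ p, but not
-- both other sides, has width at least h in the direction x + y.  This width is
-- exactly h, since otherwise a vertex of extremal level x + y could be moved
-- inwards without losing lattice size; hence, in the coordinates x and x + y,
-- the polygon meets all four sides of a box.
module Submission where

open import Defs
open import Data.Integer using (ℤ; 0ℤ; 1ℤ; _+_; _-_; _⊓_; _≤_; _<_)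
open import Data.Product using (_×_; _,_; ∃-syntax)
open import Data.Rational.Literals using (fromℤ)
open import Data.Sum using (_⊎_)

open import Algebra.Bundles using (module CommutativeRing)
open import Data.Empty using (⊥-elim)
open import Data.Fin.Base using (Fin; zero; suc)
open import Data.Fin.Patterns using (0F; 1F; 2F; 3F)
open import Data.Integer using (-1ℤ; _*_; -_; +≤+; nonNegative; positive)
import Data.Integer.Properties as ℤₚ
open import Data.Integer.Tactic.RingSolver using (solve)
open import Data.Nat.Base using (ℕ; zero; suc; z≤n)
open import Data.Product using (∃; proj₁; proj₂)
open import Data.Rational as ℚ using (ℚ; 0ℚ; 1ℚ)
import Data.Rational.Properties as ℚₚ
import Data.Rational.Unnormalised.Base as ℚᵘ
import Data.Rational.Unnormalised.Properties as ℚᵘₚ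
open import Data.Sum as Sum using (inj₁; inj₂)
open import Data.Vec.Functional as Vec using (Vector; tail)
open import Function.Base using (_∘_; _$_; flip)
open import Level using (0ℓ)
open import Relation.Binary.Definitions using (tri<; tri≈; tri>)
open import Relation.Binary.PropositionalEquality
open import Relation.Nullary using (¬_; Dec; yes; no; contradiction)
open import Relation.Nullary.Decidable using (map′; dec⇒maybe; decidable-stable)
open import Relation.Unary using (_⊆_; _≐_)
open import Algebra.Properties.Semiring.Sum
  (CommutativeRing.semiring ℚₚ.+-*-commutativeRing)
  using (∑-comm; *-distribˡ-sum; *-distribʳ-sum; sum-cong-≗; sum-replicate-zero)
open import Tactic.RingSolver using () renaming (solve to solve-in)
import Tactic.RingSolver.Core.AlmostCommutativeRing as ACR

-- Why the levels `x + y` govern a polygon through `(0 , p)` and `(h , q)`: as -h ≤ q - p ≤ 0, these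
-- two points alone give width at least h in every direction (α, β) with α ≥ 1 and β < α. Up to sign
-- there remain α = 0, which cannot occur twice in a basis, and β ≥ α ≥ 1, which is settled by any
-- two points whose levels differ by at least h. Hence the other vertices may be moved or dropped as
-- long as such a pair survives.
--
-- The inequality in (c) stands for four comparisons q < p, q < r, s < p, s < r between the points
-- `(0 , p)`, `(h , q)`, `(r , 0)`, `(s , h)` on the four sides. An equality leaves two or three of
-- them with lattice size h, against minimality or giving the segment (a). In (b) a corner lies on
-- two sides, and q = r is harmless since there is no fourth point to drop.
--
-- Minimality is given as a negated statement about regions, but the proof uses that a vertex lies
-- in a smaller hull. Deciding membership in a hull by Fourier-Motzkin elimination bridges the two
-- constructively.

module _ where

  -- The constructors of lists would clash with those of functional vectors in
  -- the statement of the theorem.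
  open import Data.List.Base using (List; []; _∷_)

  ℚ-ring : ACR.AlmostCommutativeRing 0ℓ 0ℓ
  ℚ-ring = ACR.fromCommutativeRing ℚₚ.+-*-commutativeRing λ q → dec⇒maybe (0ℚ ℚₚ.≟ q)

  -- Order on ℤ: an inequality is proved by writing the difference of its sides
  -- as a polynomial with nonnegative terms in known differences.

  Δ : ∀ {i j} → i ≤ j → 0ℤ ≤ j - i
  Δ = ℤₚ.i≤j⇒0≤j-i

  infixl 6 _⊕_
  infixl 7 _⊗_

  _⊕_ : ∀ {i j} → 0ℤ ≤ i → 0ℤ ≤ j → 0ℤ ≤ i + j
  _⊕_ = ℤₚ.+-mono-≤

  _⊗_ : ∀ {i j} → 0ℤ ≤ i → 0ℤ ≤ j → 0ℤ ≤ i * j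
  _⊗_ {i} {j} 0≤i 0≤j = ℤₚ.≤-trans (ℤₚ.≤-reflexive (sym (ℤₚ.*-zeroʳ i)))
    (ℤₚ.*-monoˡ-≤-nonNeg i {{nonNegative 0≤i}} 0≤j)

  ≤-by : ∀ {i j k} → 0ℤ ≤ k → j - i ≡ k → i ≤ j
  ≤-by 0≤k eq = ℤₚ.0≤i-j⇒j≤i (subst (0ℤ ≤_) (sym eq) 0≤k)

  fromℤ-homo-+ : ∀ i j → fromℤ (i + j) ≡ fromℤ i ℚ.+ fromℤ j
  fromℤ-homo-+ i j = ℚₚ.toℚᵘ-injective $ ℚᵘₚ.≃-sym $
    ℚᵘₚ.≃-trans (ℚₚ.toℚᵘ-homo-+ (fromℤ i) (fromℤ j)) (ℚᵘ.*≡* eq)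
    where
    eq : (i * 1ℤ + j * 1ℤ) * 1ℤ ≡ (i + j) * 1ℤ
    eq = solve (i ∷ j ∷ [])

  fromℤ-homo-* : ∀ i j → fromℤ (i * j) ≡ fromℤ i ℚ.* fromℤ j
  fromℤ-homo-* i j = ℚₚ.toℚᵘ-injective $ ℚᵘₚ.≃-sym $
    ℚᵘₚ.≃-trans (ℚₚ.toℚᵘ-homo-* (fromℤ i) (fromℤ j)) (ℚᵘ.*≡* refl)

  fromℤ-mono-≤ : ∀ {i j} → i ≤ j → fromℤ i ℚ.≤ fromℤ j
  fromℤ-mono-≤ {i} {j} i≤j = ℚ.*≤*
    (subst₂ _≤_ (sym (ℤₚ.*-identityʳ i)) (sym (ℤₚ.*-identityʳ j)) i≤j)

  fromℤ-cancel-≤ : ∀ {i j} → fromℤ i ℚ.≤ fromℤ j → i ≤ j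
  fromℤ-cancel-≤ {i} {j} (ℚ.*≤* i≤j) =
    subst₂ _≤_ (ℤₚ.*-identityʳ i) (ℤₚ.*-identityʳ j) i≤j

  fromℤ-homo-linear : ∀ a b c x y → fromℤ ((a * x + b * y) + c) ≡
    (fromℤ a ℚ.* fromℤ x ℚ.+ fromℤ b ℚ.* fromℤ y) ℚ.+ fromℤ c
  fromℤ-homo-linear a b c x y = trans (fromℤ-homo-+ (a * x + b * y) c)
    (cong (ℚ._+ fromℤ c) (trans (fromℤ-homo-+ (a * x) (b * y))
      (cong₂ ℚ._+_ (fromℤ-homo-* a x) (fromℤ-homo-* b y))))

  -- Sums over ℚ

  ∑-cong : ∀ {n} {f g : Vector ℚ n} → (∀ i → f i ≡ g i) → ∑ f ≡ ∑ g
  ∑-cong = sum-cong-≗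

  ∑-mono : ∀ {n} {f g : Vector ℚ n} → (∀ i → f i ℚ.≤ g i) → ∑ f ℚ.≤ ∑ g
  ∑-mono {zero}  f≤g = ℚₚ.≤-refl
  ∑-mono {suc n} f≤g = ℚₚ.+-mono-≤ (f≤g zero) (∑-mono (f≤g ∘ suc))

  ∑-linear : ∀ {n} a b c (t f g : Vector ℚ n) →
    ∑ (λ i → t i ℚ.* ((a ℚ.* f i ℚ.+ b ℚ.* g i) ℚ.+ c)) ≡
    (a ℚ.* ∑ (λ i → t i ℚ.* f i) ℚ.+ b ℚ.* ∑ (λ i → t i ℚ.* g i)) ℚ.+ c ℚ.* ∑ t
  ∑-linear {zero}  a b c t f g = solve-in (a ∷ b ∷ c ∷ []) ℚ-ring
  ∑-linear {suc n} a b c t f g =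
    trans (cong (t zero ℚ.* ((a ℚ.* f zero ℚ.+ b ℚ.* g zero) ℚ.+ c) ℚ.+_)
                (∑-linear a b c (tail t) (tail f) (tail g)))
          (rearrange (t zero) (f zero) (g zero) _ _ _)
    where
    rearrange : ∀ u x y X Y T →
      u ℚ.* ((a ℚ.* x ℚ.+ b ℚ.* y) ℚ.+ c) ℚ.+ ((a ℚ.* X ℚ.+ b ℚ.* Y) ℚ.+ c ℚ.* T) ≡
      (a ℚ.* (u ℚ.* x ℚ.+ X) ℚ.+ b ℚ.* (u ℚ.* y ℚ.+ Y)) ℚ.+ c ℚ.* (u ℚ.+ T)
    rearrange u x y X Y T = solve-in (a ∷ b ∷ c ∷ u ∷ x ∷ y ∷ X ∷ Y ∷ T ∷ []) ℚ-ring

  ∑-zero : ∀ {n} (f : Vector ℚ n) → ∑ (λ i → 0ℚ ℚ.* f i) ≡ 0ℚ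
  ∑-zero f = trans (sym (*-distribˡ-sum 0ℚ f)) (ℚₚ.*-zeroˡ (∑ f))

  *-nonNeg : ∀ {p q} → 0ℚ ℚ.≤ p → 0ℚ ℚ.≤ q → 0ℚ ℚ.≤ p ℚ.* q
  *-nonNeg {p} {q} 0≤p 0≤q = ℚₚ.nonNegative⁻¹ _
    {{ℚₚ.nonNeg*nonNeg⇒nonNeg p {{ℚ.nonNegative 0≤p}} q {{ℚ.nonNegative 0≤q}}}}

  ∑-nonNeg : ∀ {n} {f : Vector ℚ n} → (∀ i → 0ℚ ℚ.≤ f i) → 0ℚ ℚ.≤ ∑ f
  ∑-nonNeg {zero}  0≤f = ℚₚ.≤-refl
  ∑-nonNeg {suc n} 0≤f = ℚₚ.+-mono-≤ (0≤f zero) (∑-nonNeg (0≤f ∘ suc))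

  -- Convex hulls

  conv-vertex : ∀ {n} (V : Vector LatticePoint n) i → conv V (ι (V i))
  conv-vertex {suc n} V zero =
    (1ℚ Vec.∷ Vec.replicate n 0ℚ) ,
    (λ { zero → ℚₚ.nonNegative⁻¹ 1ℚ ; (suc _) → ℚₚ.≤-refl }) ,
    cong (1ℚ ℚ.+_) (sum-replicate-zero n) ,
    first _ (λ i → fromℤ (proj₁ (V (suc i)))) , first _ (λ i → fromℤ (proj₂ (V (suc i))))
    where
    first : ∀ q (f : Vector ℚ n) → 1ℚ ℚ.* q ℚ.+ ∑ (λ i → 0ℚ ℚ.* f i) ≡ q
    first q f = trans (cong (1ℚ ℚ.* q ℚ.+_) (∑-zero f))
                      (trans (ℚₚ.+-identityʳ _) (ℚₚ.*-identityˡ q))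
  conv-vertex {suc n} V (suc i) with conv-vertex (tail V) i
  ... | t , t≥0 , ∑t , ∑tx , ∑ty =
    (0ℚ Vec.∷ t) , (λ { zero → ℚₚ.≤-refl ; (suc j) → t≥0 j }) ,
    trans (ℚₚ.+-identityˡ _) ∑t ,
    trans (skip (fromℤ (proj₁ (V zero))) _) ∑tx , trans (skip (fromℤ (proj₂ (V zero))) _) ∑ty
    where
    skip : ∀ p q → 0ℚ ℚ.* p ℚ.+ q ≡ q
    skip p q = solve-in (p ∷ q ∷ []) ℚ-ring

  conv-resp : ∀ {n} {V W : Vector LatticePoint n} → (∀ i → V i ≡ W i) → conv V ⊆ conv W
  conv-resp V≗W (t , t≥0 , ∑t , ∑tx , ∑ty) = t , t≥0 , ∑t ,
    trans (∑-cong (λ i → cong (λ v → t i ℚ.* fromℤ (proj₁ v)) (sym (V≗W i)))) ∑tx ,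
    trans (∑-cong (λ i → cong (λ v → t i ℚ.* fromℤ (proj₂ v)) (sym (V≗W i)))) ∑ty

  -- A convex combination of convex combinations is one again: the weights multiply, and exchanging
  -- the double sum (`mix`) evaluates each coordinate.
  conv-least : ∀ {m n} {U : Vector LatticePoint m} {V : Vector LatticePoint n} →
    (∀ j → conv V (ι (U j))) → conv U ⊆ conv V
  conv-least {m} {n} {U} {V} U⊆V {x , y} (t , t≥0 , ∑t , ∑tx , ∑ty) =
    w , (λ i → ∑-nonNeg (λ j → *-nonNeg (t≥0 j) (s≥0 j i))) ,
    trans (∑-cong (λ i → sym (ℚₚ.*-identityʳ (w i))))
      (trans (mix (λ _ → 1ℚ)) (trans (∑-cong one) ∑t)) ,
    trans (mix _) (trans (∑-cong (λ j → cong (t j ℚ.*_) (proj₁ (proj₂ (proj₂ (proj₂ (U⊆V j))))))) ∑tx) ,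
    trans (mix _) (trans (∑-cong (λ j → cong (t j ℚ.*_) (proj₂ (proj₂ (proj₂ (proj₂ (U⊆V j))))))) ∑ty)
    where
    s : Fin m → Vector ℚ n
    s j = proj₁ (U⊆V j)
    s≥0 : ∀ j i → 0ℚ ℚ.≤ s j i
    s≥0 j = proj₁ (proj₂ (U⊆V j))
    w : Vector ℚ n
    w i = ∑ (λ j → t j ℚ.* s j i)
    one : ∀ j → t j ℚ.* ∑ (λ i → s j i ℚ.* 1ℚ) ≡ t j
    one j = trans (cong (t j ℚ.*_) (trans (∑-cong (λ i → ℚₚ.*-identityʳ (s j i)))
      (proj₁ (proj₂ (proj₂ (U⊆V j)))))) (ℚₚ.*-identityʳ (t j))
    mix : ∀ (f : Vector ℚ n) →
      ∑ (λ i → w i ℚ.* f i) ≡ ∑ (λ j → t j ℚ.* ∑ (λ i → s j i ℚ.* f i))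
    mix f = trans (∑-cong (λ i → *-distribʳ-sum (f i) (λ j → t j ℚ.* s j i)))
      (trans (∑-comm (λ i j → t j ℚ.* s j i ℚ.* f i))
        (∑-cong (λ j → trans (∑-cong (λ i → ℚₚ.*-assoc (t j) (s j i) (f i)))
          (sym (*-distribˡ-sum (t j) (λ i → s j i ℚ.* f i))))))

  module _ {n} {t : Vector ℚ n} (t≥0 : ∀ i → 0ℚ ℚ.≤ t i) (∑t : ∑ t ≡ 1ℚ) where

    private
      constant : ∀ m → ∑ (λ i → t i ℚ.* m) ≡ m
      constant m = trans (sym (*-distribʳ-sum m t)) (trans (cong (ℚ._* m) ∑t) (ℚₚ.*-identityˡ m))

    average-≥ : ∀ {m} {f : Vector ℚ n} → (∀ i → m ℚ.≤ f i) → m ℚ.≤ ∑ (λ i → t i ℚ.* f i)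
    average-≥ {m} m≤f = subst (ℚ._≤ _) (constant m)
      (∑-mono (λ i → ℚₚ.*-monoˡ-≤-nonNeg (t i) {{ℚ.nonNegative (t≥0 i)}} (m≤f i)))

    average-≤ : ∀ {m} {f : Vector ℚ n} → (∀ i → f i ℚ.≤ m) → ∑ (λ i → t i ℚ.* f i) ℚ.≤ m
    average-≤ {m} f≤m = subst (_ ℚ.≤_) (constant m)
      (∑-mono (λ i → ℚₚ.*-monoˡ-≤-nonNeg (t i) {{ℚ.nonNegative (t≥0 i)}} (f≤m i)))

  -- Affine unimodular maps

  open AffineUnimodular

  act : AffineUnimodular → LatticePoint → LatticePoint
  act φ (x , y) = (a₁₁ φ * x + a₁₂ φ * y) + v₁ φ , (a₂₁ φ * x + a₂₂ φ * y) + v₂ φ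

  apply-ι : ∀ φ p → apply φ (ι p) ≡ ι (act φ p)
  apply-ι φ (x , y) = sym (cong₂ _,_
    (fromℤ-homo-linear (a₁₁ φ) (a₁₂ φ) (v₁ φ) x y)
    (fromℤ-homo-linear (a₂₁ φ) (a₂₂ φ) (v₂ φ) x y))

  private
    ∑-coordinate : ∀ {n} (V : Vector LatticePoint n) a b c (t : Vector ℚ n) → ∑ t ≡ 1ℚ →
      ∑ (λ i → t i ℚ.* fromℤ ((a * proj₁ (V i) + b * proj₂ (V i)) + c)) ≡
      (fromℤ a ℚ.* ∑ (λ i → t i ℚ.* proj₁ (ι (V i))) ℚ.+
       fromℤ b ℚ.* ∑ (λ i → t i ℚ.* proj₂ (ι (V i)))) ℚ.+ fromℤ c
    ∑-coordinate V a b c t ∑t =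
      trans (∑-cong (λ i → cong (t i ℚ.*_) (fromℤ-homo-linear a b c (proj₁ (V i)) (proj₂ (V i)))))
        (trans (∑-linear (fromℤ a) (fromℤ b) (fromℤ c) t (fromℤ ∘ proj₁ ∘ V) (fromℤ ∘ proj₂ ∘ V))
          (cong ((fromℤ a ℚ.* x̄ ℚ.+ fromℤ b ℚ.* ȳ) ℚ.+_)
            (trans (cong (fromℤ c ℚ.*_) ∑t) (ℚₚ.*-identityʳ (fromℤ c)))))
      where
      x̄ ȳ : ℚ
      x̄ = ∑ (λ i → t i ℚ.* proj₁ (ι (V i)))
      ȳ = ∑ (λ i → t i ℚ.* proj₂ (ι (V i)))

  -- The means of showing that a lattice point is outside a hull: a functional that is bounded on
  -- the vertices and violates the bound at the point.
  conv-bound : ∀ {n} (V : Vector LatticePoint n) α β m →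
    (∀ i → m ≤ α * proj₁ (V i) + β * proj₂ (V i)) →
    ∀ p → conv V (ι p) → m ≤ α * proj₁ p + β * proj₂ p
  conv-bound {n} V α β m m≤V (x , y) (t , t≥0 , ∑t , ∑tx , ∑ty) = subst (m ≤_) (ℤₚ.+-identityʳ _)
    (fromℤ-cancel-≤ (subst (fromℤ m ℚ.≤_)
      (trans (∑-coordinate V α β 0ℤ t ∑t)
        (trans (cong₂ (λ X Y → (fromℤ α ℚ.* X ℚ.+ fromℤ β ℚ.* Y) ℚ.+ fromℤ 0ℤ) ∑tx ∑ty)
          (sym (fromℤ-homo-linear α β 0ℤ x y))))
      (average-≥ t≥0 ∑t (λ i → fromℤ-mono-≤ (subst (m ≤_) (sym (ℤₚ.+-identityʳ _)) (m≤V i))))))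

  conv-map : ∀ {n} φ (V : Vector LatticePoint n) → image φ (conv V) ≐ conv (act φ ∘ V)
  conv-map {n} φ V = to , from
    where
    x̄ ȳ : Vector ℚ n → ℚ
    x̄ t = ∑ (λ i → t i ℚ.* proj₁ (ι (V i)))
    ȳ t = ∑ (λ i → t i ℚ.* proj₂ (ι (V i)))
    to : image φ (conv V) ⊆ conv (act φ ∘ V)
    to (p , (t , t≥0 , ∑t , refl , refl) , refl) = t , t≥0 , ∑t ,
      ∑-coordinate V (a₁₁ φ) (a₁₂ φ) (v₁ φ) t ∑t , ∑-coordinate V (a₂₁ φ) (a₂₂ φ) (v₂ φ) t ∑t
    from : conv (act φ ∘ V) ⊆ image φ (conv V)
    from (t , t≥0 , ∑t , ∑tx , ∑ty) = (x̄ t , ȳ t) , (t , t≥0 , ∑t , refl , refl) ,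
      cong₂ _,_ (trans (sym (∑-coordinate V (a₁₁ φ) (a₁₂ φ) (v₁ φ) t ∑t)) ∑tx)
                (trans (sym (∑-coordinate V (a₂₁ φ) (a₂₂ φ) (v₂ φ) t ∑t)) ∑ty)

  conv-act : ∀ {n} φ (V : Vector LatticePoint n) {p} → conv V (ι p) → conv (act φ ∘ V) (ι (act φ p))
  conv-act φ V {p} p∈V = proj₁ (conv-map φ V) (ι p , p∈V , apply-ι φ p)

  -- Fourier–Motzkin elimination: membership in a convex hull is decidable

  module FourierMotzkin where

    open import Data.List.Base using (_++_; cartesianProductWith)
    open import Data.List.Membership.Propositional using (_∈_)
    open import Data.List.Membership.Propositional.Properties using (∈-cartesianProductWith⁺)
    open import Data.List.Relation.Unary.All as All using (All; all?)
    import Data.List.Relation.Unary.All.Properties as Allₚ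
    open import Data.List.Relation.Unary.Any using (here; there)

    Affine : ℕ → Set
    Affine n = ℚ × Vector ℚ n

    infix 8 _⟨_⟩

    _⟨_⟩ : ∀ {n} → Affine n → Vector ℚ n → ℚ
    (c , a) ⟨ t ⟩ = c ℚ.+ ∑ (λ i → a i ℚ.* t i)

    infixl 6 _⊖_
    infixl 7 _·_

    _·_ : ∀ {n} → ℚ → Affine n → Affine n
    r · (c , a) = r ℚ.* c , λ i → r ℚ.* a i

    _⊖_ : ∀ {n} → Affine n → Affine n → Affine n
    (c , a) ⊖ (d , b) = c ℚ.- d , λ i → a i ℚ.- b i

    ·-eval : ∀ {n} r (f : Affine n) t → (r · f) ⟨ t ⟩ ≡ r ℚ.* f ⟨ t ⟩
    ·-eval {n} r (c , a) t = trans
      (cong (r ℚ.* c ℚ.+_) (trans (∑-cong {n} (λ i → ℚₚ.*-assoc r (a i) (t i)))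
        (sym (*-distribˡ-sum r (λ i → a i ℚ.* t i)))))
      (sym (ℚₚ.*-distribˡ-+ r c (∑ (λ i → a i ℚ.* t i))))

    ⊖-eval : ∀ {n} (f g : Affine n) t → (f ⊖ g) ⟨ t ⟩ ≡ f ⟨ t ⟩ ℚ.- g ⟨ t ⟩
    ⊖-eval {zero}  (c , a) (d , b) t = regroup c d
      where
      regroup : ∀ c d → c ℚ.- d ℚ.+ 0ℚ ≡ (c ℚ.+ 0ℚ) ℚ.- (d ℚ.+ 0ℚ)
      regroup c d = trans (ℚₚ.+-identityʳ (c ℚ.- d))
        (cong₂ ℚ._-_ (sym (ℚₚ.+-identityʳ c)) (sym (ℚₚ.+-identityʳ d)))
    ⊖-eval {suc n} (c , a) (d , b) t = trans
      (pull c d (a zero) (b zero) (t zero) (∑ (λ i → (tail a i ℚ.- tail b i) ℚ.* tail t i)))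
      (trans (cong ((a zero ℚ.- b zero) ℚ.* t zero ℚ.+_) (⊖-eval (c , tail a) (d , tail b) (tail t)))
        (push c d (a zero) (b zero) (t zero) (∑ (λ i → tail a i ℚ.* tail t i))
          (∑ (λ i → tail b i ℚ.* tail t i))))
      where
      pull : ∀ c d a b t S →
        c ℚ.- d ℚ.+ ((a ℚ.- b) ℚ.* t ℚ.+ S) ≡ (a ℚ.- b) ℚ.* t ℚ.+ (c ℚ.- d ℚ.+ S)
      pull c d a b t S = solve-in (c ∷ d ∷ a ∷ b ∷ t ∷ S ∷ []) ℚ-ring
      push : ∀ c d a b t A B → (a ℚ.- b) ℚ.* t ℚ.+ ((c ℚ.+ A) ℚ.- (d ℚ.+ B)) ≡
        (c ℚ.+ (a ℚ.* t ℚ.+ A)) ℚ.- (d ℚ.+ (b ℚ.* t ℚ.+ B))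
      push c d a b t A B = solve-in (c ∷ d ∷ a ∷ b ∷ t ∷ A ∷ B ∷ []) ℚ-ring

    p≤q⇒0≤q-p : ∀ {p q} → p ℚ.≤ q → 0ℚ ℚ.≤ q ℚ.- p
    p≤q⇒0≤q-p {p} {q} p≤q = subst (ℚ._≤ q ℚ.- p) (ℚₚ.+-inverseʳ p) (ℚₚ.+-monoˡ-≤ (ℚ.- p) p≤q)

    0≤q-p⇒p≤q : ∀ {p q} → 0ℚ ℚ.≤ q ℚ.- p → p ℚ.≤ q
    0≤q-p⇒p≤q {p} {q} 0≤q-p = subst₂ ℚ._≤_ (ℚₚ.+-identityˡ p) eq (ℚₚ.+-monoˡ-≤ p 0≤q-p)
      where
      eq : q ℚ.- p ℚ.+ p ≡ q
      eq = solve-in (p ∷ q ∷ []) ℚ-ring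

    -- Every condition 0 ≤ f on s ∷ t is a lower bound, an upper bound or no
    -- condition on s, according to the sign of the coefficient of s.
    data Bound {n} (f : Affine (suc n)) : Set where
      lower : ∀ l → (∀ {s t} → 0ℚ ℚ.≤ f ⟨ s Vec.∷ t ⟩ → l ⟨ t ⟩ ℚ.≤ s)
                  → (∀ {s t} → l ⟨ t ⟩ ℚ.≤ s → 0ℚ ℚ.≤ f ⟨ s Vec.∷ t ⟩) → Bound f
      upper : ∀ u → (∀ {s t} → 0ℚ ℚ.≤ f ⟨ s Vec.∷ t ⟩ → s ℚ.≤ u ⟨ t ⟩)
                  → (∀ {s t} → s ℚ.≤ u ⟨ t ⟩ → 0ℚ ℚ.≤ f ⟨ s Vec.∷ t ⟩) → Bound f
      free  : ∀ g → (∀ {s t} → 0ℚ ℚ.≤ f ⟨ s Vec.∷ t ⟩ → 0ℚ ℚ.≤ g ⟨ t ⟩)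
                  → (∀ {s t} → 0ℚ ℚ.≤ g ⟨ t ⟩ → 0ℚ ℚ.≤ f ⟨ s Vec.∷ t ⟩) → Bound f

    -- Both signs of the leading coefficient reduce to division by a positive number: `b` is that
    -- coefficient or its negative, and `e` is the value of the condition.
    module Scaled {b} (0<b : 0ℚ ℚ.< b) where

      instance
        b-pos : ℚ.Positive b
        b-pos = ℚ.positive 0<b

        b-nonZero : ℚ.NonZero b
        b-nonZero = ℚₚ.pos⇒nonZero b

      b⁻¹ : ℚ
      b⁻¹ = ℚ.1/ b

      ≤-from : ∀ {p q e} → e ≡ b ℚ.* (q ℚ.- p) → 0ℚ ℚ.≤ e → p ℚ.≤ q
      ≤-from eq 0≤e = 0≤q-p⇒p≤q (ℚₚ.*-cancelˡ-≤-pos b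
        (subst₂ ℚ._≤_ (sym (ℚₚ.*-zeroʳ b)) eq 0≤e))

      ≤-to : ∀ {p q e} → e ≡ b ℚ.* (q ℚ.- p) → p ℚ.≤ q → 0ℚ ℚ.≤ e
      ≤-to eq p≤q = subst (0ℚ ℚ.≤_) (sym eq) (*-nonNeg (ℚₚ.<⇒≤ 0<b) (p≤q⇒0≤q-p p≤q))

    bound : ∀ {n} (f : Affine (suc n)) → Bound f
    bound {n} (c , a) with ℚₚ.<-cmp 0ℚ (a zero)
    ... | tri≈ _ 0≡a₀ _ = free (c , tail a)
        (λ {s} → subst (0ℚ ℚ.≤_) (drop s _)) (λ {s} → subst (0ℚ ℚ.≤_) (sym (drop s _)))
      where
      drop : ∀ s S → c ℚ.+ (a zero ℚ.* s ℚ.+ S) ≡ c ℚ.+ S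
      drop s S = cong (c ℚ.+_) (trans (cong (λ α → α ℚ.* s ℚ.+ S) (sym 0≡a₀))
        (trans (cong (ℚ._+ S) (ℚₚ.*-zeroˡ s)) (ℚₚ.+-identityˡ S)))
    ... | tri< 0<a₀ _ _ = lower ((ℚ.- b⁻¹) · g) (λ {s} {t} → ≤-from (eq s t)) (λ {s} {t} → ≤-to (eq s t))
      where
      open Scaled 0<a₀
      g : Affine n
      g = c , tail a
      eq : ∀ s t → (c , a) ⟨ s Vec.∷ t ⟩ ≡ a zero ℚ.* (s ℚ.- ((ℚ.- b⁻¹) · g) ⟨ t ⟩)
      eq s t = sym (trans (cong (λ e → a zero ℚ.* (s ℚ.- e)) (·-eval (ℚ.- b⁻¹) g t))
        (trans (expand (a zero) b⁻¹ s c _)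
          (trans (cong (λ e → a zero ℚ.* s ℚ.+ e ℚ.* g ⟨ t ⟩) (ℚₚ.*-inverseʳ (a zero)))
            (regroup (a zero) s c _))))
        where
        expand : ∀ α r s c S → α ℚ.* (s ℚ.- (ℚ.- r) ℚ.* (c ℚ.+ S)) ≡ α ℚ.* s ℚ.+ (α ℚ.* r) ℚ.* (c ℚ.+ S)
        expand α r s c S = solve-in (α ∷ r ∷ s ∷ c ∷ S ∷ []) ℚ-ring
        regroup : ∀ α s c S → α ℚ.* s ℚ.+ 1ℚ ℚ.* (c ℚ.+ S) ≡ c ℚ.+ (α ℚ.* s ℚ.+ S)
        regroup α s c S = solve-in (α ∷ s ∷ c ∷ S ∷ []) ℚ-ring
    ... | tri> _ _ a₀<0 = upper (b⁻¹ · g) (λ {s} {t} → ≤-from (eq s t)) (λ {s} {t} → ≤-to (eq s t))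
      where
      open Scaled (ℚₚ.neg-antimono-< a₀<0)
      b : ℚ
      b = ℚ.- a zero
      g : Affine n
      g = c , tail a
      eq : ∀ s t → (c , a) ⟨ s Vec.∷ t ⟩ ≡ b ℚ.* ((b⁻¹ · g) ⟨ t ⟩ ℚ.- s)
      eq s t = sym (trans (cong (λ e → b ℚ.* (e ℚ.- s)) (·-eval b⁻¹ g t))
        (trans (expand b b⁻¹ s c _)
          (trans (cong (λ e → e ℚ.* g ⟨ t ⟩ ℚ.- b ℚ.* s) (ℚₚ.*-inverseʳ b))
            (regroup (a zero) s c _))))
        where
        expand : ∀ β r s c S → β ℚ.* (r ℚ.* (c ℚ.+ S) ℚ.- s) ≡ (β ℚ.* r) ℚ.* (c ℚ.+ S) ℚ.- β ℚ.* s
        expand β r s c S = solve-in (β ∷ r ∷ s ∷ c ∷ S ∷ []) ℚ-ring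
        regroup : ∀ α s c S → 1ℚ ℚ.* (c ℚ.+ S) ℚ.- (ℚ.- α) ℚ.* s ≡ c ℚ.+ (α ℚ.* s ℚ.+ S)
        regroup α s c S = solve-in (α ∷ s ∷ c ∷ S ∷ []) ℚ-ring

    Solution : ∀ {n} → List (Affine n) → Vector ℚ n → Set
    Solution fs t = All (λ f → 0ℚ ℚ.≤ f ⟨ t ⟩) fs

    record Bounds {n} (fs : List (Affine (suc n))) : Set where
      field
        lowers uppers frees : List (Affine n)
        split : ∀ {s t} → Solution fs (s Vec.∷ t) →
          All (λ l → l ⟨ t ⟩ ℚ.≤ s) lowers × All (λ u → s ℚ.≤ u ⟨ t ⟩) uppers × Solution frees t
        merge : ∀ {s t} → All (λ l → l ⟨ t ⟩ ℚ.≤ s) lowers → All (λ u → s ℚ.≤ u ⟨ t ⟩) uppers →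
          Solution frees t → Solution fs (s Vec.∷ t)

    bounds : ∀ {n} (fs : List (Affine (suc n))) → Bounds fs
    bounds [] = record
      { lowers = [] ; uppers = [] ; frees = []
      ; split = λ _ → All.[] , All.[] , All.[] ; merge = λ _ _ _ → All.[] }
    bounds (f ∷ fs) with bound f | bounds fs
    ... | lower l f⇒l l⇒f | B = record
      { lowers = l ∷ lowers ; uppers = uppers ; frees = frees
      ; split  = λ { (0≤f All.∷ 0≤fs) → let ls , us , gs = split 0≤fs in f⇒l 0≤f All.∷ ls , us , gs }
      ; merge  = λ { (l≤s All.∷ ls) us gs → l⇒f l≤s All.∷ merge ls us gs }
      } where open Bounds B
    ... | upper u f⇒u u⇒f | B = record
      { lowers = lowers ; uppers = u ∷ uppers ; frees = frees
      ; split  = λ { (0≤f All.∷ 0≤fs) → let ls , us , gs = split 0≤fs in ls , f⇒u 0≤f All.∷ us , gs }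
      ; merge  = λ { ls (s≤u All.∷ us) gs → u⇒f s≤u All.∷ merge ls us gs }
      } where open Bounds B
    ... | free g f⇒g g⇒f | B = record
      { lowers = lowers ; uppers = uppers ; frees = g ∷ frees
      ; split = λ { {s} (0≤f All.∷ 0≤fs) → let ls , us , gs = split 0≤fs in ls , us , f⇒g {s} 0≤f All.∷ gs }
      ; merge = λ { ls us (0≤g All.∷ gs) → g⇒f 0≤g All.∷ merge ls us gs }
      } where open Bounds B

    -- The value found is the greatest among 0 and the lower bounds. Starting from 0 makes it
    -- nonnegative and also covers the case of no lower bounds.
    supremum : ∀ {A : Set} (f : A → ℚ) ls us →
      All (λ u → 0ℚ ℚ.≤ f u) us → (∀ {u l} → u ∈ us → l ∈ ls → f l ℚ.≤ f u) →
      ∃ λ s → 0ℚ ℚ.≤ s × All (λ l → f l ℚ.≤ s) ls × All (λ u → s ℚ.≤ f u) us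
    supremum f []       us 0≤us ls≤us = 0ℚ , ℚₚ.≤-refl , All.[] , 0≤us
    supremum f (l ∷ ls) us 0≤us ls≤us
      with supremum f ls us 0≤us (λ u∈us l∈ls → ls≤us u∈us (there l∈ls))
    ... | s , 0≤s , ls≤s , s≤us with ℚₚ.≤-total (f l) s
    ...   | inj₁ l≤s = s , 0≤s , l≤s All.∷ ls≤s , s≤us
    ...   | inj₂ s≤l = f l , ℚₚ.≤-trans 0≤s s≤l ,
            ℚₚ.≤-refl All.∷ All.map (flip ℚₚ.≤-trans s≤l) ls≤s ,
            All.tabulate (λ u∈us → ls≤us u∈us (here refl))

    -- The variables range over the nonnegative rationals, so that 0 is a further
    -- lower bound for each of them.
    feasible? : ∀ {n} (fs : List (Affine n)) → Dec (∃ λ t → (∀ i → 0ℚ ℚ.≤ t i) × Solution fs t)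
    feasible? {zero} fs = map′ (λ sol → (λ ()) , (λ ()) , sol) (λ { (_ , _ , sol) → sol })
      (all? (λ f → 0ℚ ℚₚ.≤? f ⟨ (λ ()) ⟩) fs)
    feasible? {suc n} fs = map′ extend project (feasible? (frees ++ (uppers ++ gaps)))
      where
      open Bounds (bounds fs)
      gaps : List (Affine n)
      gaps = cartesianProductWith _⊖_ uppers lowers
      extend : (∃ λ t → (∀ i → 0ℚ ℚ.≤ t i) × Solution (frees ++ (uppers ++ gaps)) t) →
        ∃ λ t → (∀ i → 0ℚ ℚ.≤ t i) × Solution fs t
      extend (t , t≥0 , sol) =
        let ok-frees , rest = Allₚ.++⁻ frees sol
            0≤us , 0≤gaps   = Allₚ.++⁻ uppers rest
            s , 0≤s , ls≤s , s≤us = supremum (_⟨ t ⟩) lowers uppers 0≤us λ {u} {l} u∈us l∈ls →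
              0≤q-p⇒p≤q (subst (0ℚ ℚ.≤_) (⊖-eval u l t)
                (All.lookup 0≤gaps (∈-cartesianProductWith⁺ _⊖_ u∈us l∈ls)))
        in (s Vec.∷ t) , (λ { zero → 0≤s ; (suc i) → t≥0 i }) , merge ls≤s s≤us ok-frees
      project : (∃ λ t → (∀ i → 0ℚ ℚ.≤ t i) × Solution fs t) →
        ∃ λ t → (∀ i → 0ℚ ℚ.≤ t i) × Solution (frees ++ (uppers ++ gaps)) t
      project (t , t≥0 , sol) =
        let ls , us , gs = split {t zero} {tail t} sol
        in tail t , (λ i → t≥0 (suc i)) , Allₚ.++⁺ gs (Allₚ.++⁺
          (All.map (ℚₚ.≤-trans (t≥0 zero)) us)
          (Allₚ.cartesianProductWith⁺ (setoid _) (setoid _) _⊖_ uppers lowers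
            λ {u} {l} u∈us l∈ls → subst (0ℚ ℚ.≤_) (sym (⊖-eval u l (tail t)))
              (p≤q⇒0≤q-p (ℚₚ.≤-trans (All.lookup ls l∈ls) (All.lookup us u∈us)))))

    equation : ∀ {n} → ℚ → Vector ℚ n → List (Affine n)
    equation {n} c a = f ∷ (ℚ.- 1ℚ) · f ∷ []
      where
      f : Affine n
      f = ℚ.- c , a

    private
      equation-eval : ∀ {n} c (a t : Vector ℚ n) →
        (ℚ.- c , a) ⟨ t ⟩ ≡ ∑ (λ i → t i ℚ.* a i) ℚ.- c
      equation-eval {n} c a t = trans (ℚₚ.+-comm (ℚ.- c) _)
        (cong (ℚ._- c) (∑-cong {n} (λ i → ℚₚ.*-comm (a i) (t i))))

      neg-eval : ∀ {n} (f : Affine n) t → ((ℚ.- 1ℚ) · f) ⟨ t ⟩ ≡ ℚ.- (f ⟨ t ⟩)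
      neg-eval f t = trans (·-eval (ℚ.- 1ℚ) f t)
        (trans (sym (ℚₚ.neg-distribˡ-* 1ℚ (f ⟨ t ⟩))) (cong ℚ.-_ (ℚₚ.*-identityˡ (f ⟨ t ⟩))))

    equation-sound : ∀ {n c} {a t : Vector ℚ n} → Solution (equation c a) t → ∑ (λ i → t i ℚ.* a i) ≡ c
    equation-sound {n} {c} {a} {t} (0≤f All.∷ 0≤-f All.∷ All.[]) = ℚₚ.≤-antisym
      (0≤q-p⇒p≤q (subst (0ℚ ℚ.≤_) (trans (neg-eval (ℚ.- c , a) t)
        (trans (cong ℚ.-_ (equation-eval c a t)) (flipped _))) 0≤-f))
      (0≤q-p⇒p≤q (subst (0ℚ ℚ.≤_) (equation-eval c a t) 0≤f))
      where
      flipped : ∀ q → ℚ.- (q ℚ.- c) ≡ c ℚ.- q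
      flipped q = solve-in (q ∷ c ∷ []) ℚ-ring

    equation-complete : ∀ {n c} {a t : Vector ℚ n} → ∑ (λ i → t i ℚ.* a i) ≡ c → Solution (equation c a) t
    equation-complete {n} {c} {a} {t} eq = ℚₚ.≤-reflexive (sym f≡0) All.∷
      ℚₚ.≤-reflexive (sym (trans (neg-eval (ℚ.- c , a) t) (cong ℚ.-_ f≡0))) All.∷ All.[]
      where
      f≡0 : (ℚ.- c , a) ⟨ t ⟩ ≡ 0ℚ
      f≡0 = trans (equation-eval c a t) (trans (cong (ℚ._- c) eq) (ℚₚ.+-inverseʳ c))

    conv? : ∀ {n} (V : Vector LatticePoint n) z → Dec (conv V z)
    conv? {n} V (x , y) = map′ to from (feasible? (mass ++ (abscissa ++ ordinate)))
      where
      mass abscissa ordinate : List (Affine n)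
      mass     = equation 1ℚ (λ _ → 1ℚ)
      abscissa = equation x (λ i → proj₁ (ι (V i)))
      ordinate = equation y (λ i → proj₂ (ι (V i)))
      total : ∀ (t : Vector ℚ n) → ∑ (λ i → t i ℚ.* 1ℚ) ≡ ∑ t
      total t = ∑-cong (λ i → ℚₚ.*-identityʳ (t i))
      to : (∃ λ t → (∀ i → 0ℚ ℚ.≤ t i) × Solution (mass ++ (abscissa ++ ordinate)) t) → conv V (x , y)
      to (t , t≥0 , sol) =
        let m , rest = Allₚ.++⁻ mass sol
            ax , ay  = Allₚ.++⁻ abscissa rest
        in t , t≥0 , trans (sym (total t)) (equation-sound m) , equation-sound ax , equation-sound ay
      from : conv V (x , y) → ∃ λ t → (∀ i → 0ℚ ℚ.≤ t i) × Solution (mass ++ (abscissa ++ ordinate)) t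
      from (t , t≥0 , ∑t , ∑tx , ∑ty) = t , t≥0 ,
        Allₚ.++⁺ (equation-complete (trans (total t) ∑t))
          (Allₚ.++⁺ (equation-complete ∑tx) (equation-complete ∑ty))

  open FourierMotzkin using (conv?)

  -- Composition and inverses of affine unimodular maps

  Unit : ℤ → Set
  Unit d = d ≡ 1ℤ ⊎ d ≡ -1ℤ

  Unit-* : ∀ {c d} → Unit c → Unit d → Unit (c * d)
  Unit-* (inj₁ refl) (inj₁ refl) = inj₁ refl
  Unit-* (inj₁ refl) (inj₂ refl) = inj₂ refl
  Unit-* (inj₂ refl) (inj₁ refl) = inj₂ refl
  Unit-* (inj₂ refl) (inj₂ refl) = inj₁ refl

  Unit-square : ∀ {d} → Unit d → d * d ≡ 1ℤ
  Unit-square (inj₁ refl) = refl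
  Unit-square (inj₂ refl) = refl

  det-* : ∀ a b c d a′ b′ c′ d′ →
    (a * a′ + b * c′) * (c * b′ + d * d′) - (a * b′ + b * d′) * (c * a′ + d * c′) ≡
    (a * d - b * c) * (a′ * d′ - b′ * c′)
  det-* a b c d a′ b′ c′ d′ = solve (a ∷ b ∷ c ∷ d ∷ a′ ∷ b′ ∷ c′ ∷ d′ ∷ [])

  infixr 9 _⊚_

  _⊚_ : AffineUnimodular → AffineUnimodular → AffineUnimodular
  ψ ⊚ φ = record
    { a₁₁ = a₁₁ ψ * a₁₁ φ + a₁₂ ψ * a₂₁ φ
    ; a₁₂ = a₁₁ ψ * a₁₂ φ + a₁₂ ψ * a₂₂ φ
    ; a₂₁ = a₂₁ ψ * a₁₁ φ + a₂₂ ψ * a₂₁ φ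
    ; a₂₂ = a₂₁ ψ * a₁₂ φ + a₂₂ ψ * a₂₂ φ
    ; v₁  = (a₁₁ ψ * v₁ φ + a₁₂ ψ * v₂ φ) + v₁ ψ
    ; v₂  = (a₂₁ ψ * v₁ φ + a₂₂ ψ * v₂ φ) + v₂ ψ
    ; det≡±1 = subst Unit
        (sym (det-* (a₁₁ ψ) (a₁₂ ψ) (a₂₁ ψ) (a₂₂ ψ) (a₁₁ φ) (a₁₂ φ) (a₂₁ φ) (a₂₂ φ)))
        (Unit-* (det≡±1 ψ) (det≡±1 φ))
    }

  act-⊚ : ∀ ψ φ p → act (ψ ⊚ φ) p ≡ act ψ (act φ p)
  act-⊚ ψ φ (x , y) = cong₂ _,_
    (expand (a₁₁ ψ) (a₁₂ ψ) (v₁ ψ) (a₁₁ φ) (a₁₂ φ) (a₂₁ φ) (a₂₂ φ) (v₁ φ) (v₂ φ))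
    (expand (a₂₁ ψ) (a₂₂ ψ) (v₂ ψ) (a₁₁ φ) (a₁₂ φ) (a₂₁ φ) (a₂₂ φ) (v₁ φ) (v₂ φ))
    where
    expand : ∀ a b v a′ b′ c′ d′ v′ w′ →
      ((a * a′ + b * c′) * x + (a * b′ + b * d′) * y) + ((a * v′ + b * w′) + v) ≡
      (a * ((a′ * x + b′ * y) + v′) + b * ((c′ * x + d′ * y) + w′)) + v
    expand a b v a′ b′ c′ d′ v′ w′ =
      solve (a ∷ b ∷ v ∷ a′ ∷ b′ ∷ c′ ∷ d′ ∷ v′ ∷ w′ ∷ x ∷ y ∷ [])

  module Inverse (φ : AffineUnimodular) where

    private
      a b c d v w e : ℤ
      a = a₁₁ φ
      b = a₁₂ φ
      c = a₂₁ φ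
      d = a₂₂ φ
      v = v₁ φ
      w = v₂ φ
      e = det φ

      det-inverse : ∀ a b c d e →
        (e * d) * (e * a) - (- (e * b)) * (- (e * c)) ≡ (e * e) * (a * d - b * c)
      det-inverse a b c d e = solve (a ∷ b ∷ c ∷ d ∷ e ∷ [])

      cancel : ∀ z u → (e * e) * (z - u) + u ≡ z
      cancel z u = trans (cong (λ s → s * (z - u) + u) (Unit-square (det≡±1 φ))) (solve (z ∷ u ∷ []))

    -- The inverse matrix is the adjugate times `e`, because the determinant `e` is its own inverse.
    φ⁻¹ : AffineUnimodular
    φ⁻¹ = record
      { a₁₁ = e * d ; a₁₂ = - (e * b) ; a₂₁ = - (e * c) ; a₂₂ = e * a
      ; v₁  = - ((e * d) * v + (- (e * b)) * w)
      ; v₂  = - ((- (e * c)) * v + (e * a) * w)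
      ; det≡±1 = subst Unit (sym (det-inverse a b c d e))
          (Unit-* (Unit-* (det≡±1 φ) (det≡±1 φ)) (det≡±1 φ))
      }

    act-inverseʳ : ∀ p → act φ (act φ⁻¹ p) ≡ p
    act-inverseʳ (x , y) = cong₂ _,_
      (trans (first a b c d v w e x y) (cancel x v)) (trans (second a b c d v w e x y) (cancel y w))
      where
      first : ∀ a b c d v w e x y →
        (a * (((e * d) * x + (- (e * b)) * y) + (- ((e * d) * v + (- (e * b)) * w))) +
         b * (((- (e * c)) * x + (e * a) * y) + (- ((- (e * c)) * v + (e * a) * w)))) + v ≡
        (e * (a * d - b * c)) * (x - v) + v
      first a b c d v w e x y = solve (a ∷ b ∷ c ∷ d ∷ v ∷ w ∷ e ∷ x ∷ y ∷ [])
      second : ∀ a b c d v w e x y →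
        (c * (((e * d) * x + (- (e * b)) * y) + (- ((e * d) * v + (- (e * b)) * w))) +
         d * (((- (e * c)) * x + (e * a) * y) + (- ((- (e * c)) * v + (e * a) * w)))) + w ≡
        (e * (a * d - b * c)) * (y - w) + w
      second a b c d v w e x y = solve (a ∷ b ∷ c ∷ d ∷ v ∷ w ∷ e ∷ x ∷ y ∷ [])

    act-inverseˡ : ∀ p → act φ⁻¹ (act φ p) ≡ p
    act-inverseˡ (x , y) = cong₂ _,_
      (trans (first a b c d v w e x y) (fixed x)) (trans (second a b c d v w e x y) (fixed y))
      where
      first : ∀ a b c d v w e x y →
        ((e * d) * ((a * x + b * y) + v) + (- (e * b)) * ((c * x + d * y) + w)) +
          (- ((e * d) * v + (- (e * b)) * w)) ≡ (e * (a * d - b * c)) * x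
      first a b c d v w e x y = solve (a ∷ b ∷ c ∷ d ∷ v ∷ w ∷ e ∷ x ∷ y ∷ [])
      second : ∀ a b c d v w e x y →
        ((- (e * c)) * ((a * x + b * y) + v) + (e * a) * ((c * x + d * y) + w)) +
          (- ((- (e * c)) * v + (e * a) * w)) ≡ (e * (a * d - b * c)) * y
      second a b c d v w e x y = solve (a ∷ b ∷ c ∷ d ∷ v ∷ w ∷ e ∷ x ∷ y ∷ [])
      fixed : ∀ z → (e * e) * z ≡ z
      fixed z = trans (cong (_* z) (Unit-square (det≡±1 φ))) (ℤₚ.*-identityˡ z)

  open Inverse

  -- Widths

  -- A lower bound on the width needs only two witnesses, so no maximum or minimum over the vertices
  -- enters.
  record Spread {n} (h : ℤ) (U : Vector LatticePoint n) (α β : ℤ) : Set where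
    constructor spread
    field
      i j   : Fin n
      width : h ≤ α * (proj₁ (U i) - proj₁ (U j)) + β * (proj₂ (U i) - proj₂ (U j))

  -- By Wide⇒≤ and ≤⇒Wide, conv U has lattice size at least h.
  Wide : ∀ {n} → ℤ → Vector LatticePoint n → Set
  Wide h U = ∀ α β γ δ → Unit (α * δ - β * γ) → Spread h U α β ⊎ Spread h U γ δ

  -- Directions are row vectors: a direction on the image is its product with the matrix of `φ` on
  -- the original, and this product takes bases to bases.
  Wide-act : ∀ {n h} {U : Vector LatticePoint n} φ → Wide h U → Wide h (act φ ∘ U)
  Wide-act {h = h} {U} φ wide α β γ δ unit = Sum.map (pull α β) (pull γ δ)
    (wide (α * a₁₁ φ + β * a₂₁ φ) (α * a₁₂ φ + β * a₂₂ φ)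
          (γ * a₁₁ φ + δ * a₂₁ φ) (γ * a₁₂ φ + δ * a₂₂ φ)
          (subst Unit (sym (det-* α β γ δ (a₁₁ φ) (a₁₂ φ) (a₂₁ φ) (a₂₂ φ)))
            (Unit-* unit (det≡±1 φ))))
    where
    expand : ∀ α β a b c d v w x y x′ y′ →
      (α * a + β * c) * (x - x′) + (α * b + β * d) * (y - y′) ≡
      α * (((a * x + b * y) + v) - ((a * x′ + b * y′) + v)) +
      β * (((c * x + d * y) + w) - ((c * x′ + d * y′) + w))
    expand α β a b c d v w x y x′ y′ =
      solve (α ∷ β ∷ a ∷ b ∷ c ∷ d ∷ v ∷ w ∷ x ∷ y ∷ x′ ∷ y′ ∷ [])
    pull : ∀ α β → Spread h U (α * a₁₁ φ + β * a₂₁ φ) (α * a₁₂ φ + β * a₂₂ φ) →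
      Spread h (act φ ∘ U) α β
    pull α β (spread i j h≤) = spread i j $ subst (h ≤_)
      (expand α β (a₁₁ φ) (a₁₂ φ) (a₂₁ φ) (a₂₂ φ) (v₁ φ) (v₂ φ)
        (proj₁ (U i)) (proj₂ (U i)) (proj₁ (U j)) (proj₂ (U j))) h≤

  -- Minimality for lists of vertices

  InBox : ∀ {n} → ℤ → Vector LatticePoint n → Set
  InBox h V = ∀ i → (0ℤ ≤ proj₁ (V i) × proj₁ (V i) ≤ h) × (0ℤ ≤ proj₂ (V i) × proj₂ (V i) ≤ h)

  -- A positive form of minimality, with `Wide` in place of an exact lattice size: the upper bound
  -- is inherited by every subpolygon.
  record Minimal {n} (h : ℤ) (V : Vector LatticePoint (suc n)) : Set where
    field
      wide  : Wide h V
      least : ∀ {m} (U : Vector LatticePoint (suc m)) → (∀ j → conv V (ι (U j))) →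
              Wide h U → ∀ i → conv U (ι (V i))

  open Minimal public

  Minimal-act : ∀ {n h} {V : Vector LatticePoint (suc n)} φ → Minimal h V → Minimal h (act φ ∘ V)
  Minimal-act {h = h} {V} φ min = record
    { wide  = Wide-act φ (wide min)
    ; least = λ U U⊆V U-wide i →
        conv-resp (λ j → act-inverseʳ φ (U j)) (conv-act φ (act (φ⁻¹ φ) ∘ U)
          (least min (act (φ⁻¹ φ) ∘ U)
            (λ j → conv-resp (λ k → act-inverseˡ φ (V k)) (conv-act (φ⁻¹ φ) (act φ ∘ V) (U⊆V j)))
            (Wide-act (φ⁻¹ φ) U-wide) i))
    }

  ≃-pullback : ∀ {n} {V : Vector LatticePoint n} {Q} φ → conv (act φ ∘ V) ≃ Q → conv V ≃ Q
  ≃-pullback {V = V} {Q} φ (ψ , ⊆Q , Q⊆) = ψ ⊚ φ ,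
    (λ p∈ → ⊆Q (proj₂ (conv-map ψ (act φ ∘ V))
      (conv-resp (λ i → act-⊚ ψ φ (V i)) (proj₁ (conv-map (ψ ⊚ φ) V) p∈)))) ,
    (λ q∈ → proj₂ (conv-map (ψ ⊚ φ) V)
      (conv-resp (λ i → sym (act-⊚ ψ φ (V i))) (proj₁ (conv-map ψ (act φ ∘ V)) (Q⊆ q∈))))

  ≃-respˡ : ∀ {P P′ Q} → P ≐ P′ → P′ ≃ Q → P ≃ Q
  ≃-respˡ (P⊆P′ , P′⊆P) (φ , ⊆Q , Q⊆) = φ ,
    (λ { (p , p∈P , eq) → ⊆Q (p , P⊆P′ p∈P , eq) }) ,
    (λ q∈Q → let p , p∈P′ , eq = Q⊆ q∈Q in p , P′⊆P p∈P′ , eq)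

  -- Lattice size

  argmin : ∀ {n} (f : Fin (suc n) → ℤ) → ∃[ i ] ∀ j → f i ≤ f j
  argmin {zero}  f = zero , λ { zero → ℤₚ.≤-refl }
  argmin {suc n} f with argmin (f ∘ suc)
  ... | i , fi≤ with ℤₚ.≤-total (f zero) (f (suc i))
  ...   | inj₁ f0≤fi = zero , λ { zero → ℤₚ.≤-refl ; (suc j) → ℤₚ.≤-trans f0≤fi (fi≤ j) }
  ...   | inj₂ fi≤f0 = suc i , λ { zero → fi≤f0 ; (suc j) → fi≤ j }

  -- Widths are integers, so a width below `h` is at most `h - 1`. The translation `v` moves the
  -- minimum to 0; two narrow rows then form a map into a box of side `h - 1`.
  narrow-or-spread : ∀ {n} h (V : Vector LatticePoint (suc n)) α β →
    (∃[ v ] ∀ i → let z = (α * proj₁ (V i) + β * proj₂ (V i)) + v in 0ℤ ≤ z × z ≤ h - 1ℤ)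
    ⊎ Spread h V α β
  narrow-or-spread h V α β with argmin (λ i → α * proj₁ (V i) + β * proj₂ (V i))
                              | argmin (λ i → - (α * proj₁ (V i) + β * proj₂ (V i)))
  ... | lo , lo≤ | hi , ≤hi
    with h ℤₚ.≤? α * (proj₁ (V hi) - proj₁ (V lo)) + β * (proj₂ (V hi) - proj₂ (V lo))
  ... | yes wide = inj₂ (spread hi lo wide)
  ... | no  thin = inj₁ (- (α * proj₁ (V lo) + β * proj₂ (V lo)) , λ i →
          Δ (lo≤ i) ,
          upper-bound α β _ (proj₁ (V hi)) (proj₁ (V lo)) (proj₂ (V hi)) (proj₂ (V lo))
            (≤hi i) (ℤₚ.i<j⇒suc[i]≤j (ℤₚ.≰⇒> thin)))
    where
    upper-bound : ∀ α β u x x′ y y′ → - (α * x + β * y) ≤ - u →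
      1ℤ + (α * (x - x′) + β * (y - y′)) ≤ h → u - (α * x′ + β * y′) ≤ h - 1ℤ
    upper-bound α β u x x′ y y′ p q =
      ≤-by (Δ p ⊕ Δ q) (solve (h ∷ u ∷ α ∷ β ∷ x ∷ x′ ∷ y ∷ y′ ∷ []))

  conv-box : ∀ {n h} {V : Vector LatticePoint n} → InBox h V → conv V ⊆ fromℤ h □
  conv-box {h = h} {V} box (t , t≥0 , ∑t , refl , refl) =
    (average-≥ t≥0 ∑t (λ i → fromℤ-mono-≤ (proj₁ (proj₁ (box i)))) ,
     average-≤ t≥0 ∑t (λ i → fromℤ-mono-≤ (proj₂ (proj₁ (box i))))) ,
    (average-≥ t≥0 ∑t (λ i → fromℤ-mono-≤ (proj₁ (proj₂ (box i)))) ,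
     average-≤ t≥0 ∑t (λ i → fromℤ-mono-≤ (proj₂ (proj₂ (box i)))))

  box-fits : ∀ {n h} (V : Vector LatticePoint n) φ → InBox h (act φ ∘ V) → FitsIn (conv V) (fromℤ h)
  box-fits V φ box = φ , λ p∈ → conv-box box (proj₁ (conv-map φ V) p∈)

  fits-vertex : ∀ {n l} (V : Vector LatticePoint n) φ → image φ (conv V) ⊆ l □ →
    ∀ i → (l □) (ι (act φ (V i)))
  fits-vertex V φ fits i = fits (ι (V i) , conv-vertex V i , apply-ι φ (V i))

  fits-box : ∀ {n h} (V : Vector LatticePoint n) φ → image φ (conv V) ⊆ fromℤ h □ → InBox h (act φ ∘ V)
  fits-box V φ fits i = let (0≤x , x≤h) , (0≤y , y≤h) = fits-vertex V φ fits i in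
    (fromℤ-cancel-≤ 0≤x , fromℤ-cancel-≤ x≤h) , (fromℤ-cancel-≤ 0≤y , fromℤ-cancel-≤ y≤h)

  private
    spread-≤ : ∀ {h} a b v x y x′ y′ → h ≤ a * (x - x′) + b * (y - y′) →
      0ℤ ≤ (a * x′ + b * y′) + v → h ≤ (a * x + b * y) + v
    spread-≤ {h} a b v x y x′ y′ p q = ≤-by (Δ p ⊕ q)
      (solve (h ∷ a ∷ b ∷ v ∷ x ∷ y ∷ x′ ∷ y′ ∷ []))

  -- The rows of a map into the square form a basis, so one of them spreads by `h`; the lower of the
  -- two vertices has a nonnegative coordinate there, hence the upper one has at least `h`.
  Wide⇒≤ : ∀ {n h l} (V : Vector LatticePoint n) → Wide h V → FitsIn (conv V) l → fromℤ h ℚ.≤ l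
  Wide⇒≤ {h = h} V wide (φ , fits) with wide (a₁₁ φ) (a₁₂ φ) (a₂₁ φ) (a₂₂ φ) (det≡±1 φ)
  ... | inj₁ (spread i j h≤) = ℚₚ.≤-trans
    (fromℤ-mono-≤ (spread-≤ (a₁₁ φ) (a₁₂ φ) (v₁ φ)
      (proj₁ (V i)) (proj₂ (V i)) (proj₁ (V j)) (proj₂ (V j)) h≤
      (fromℤ-cancel-≤ (proj₁ (proj₁ (fits-vertex V φ fits j))))))
    (proj₂ (proj₁ (fits-vertex V φ fits i)))
  ... | inj₂ (spread i j h≤) = ℚₚ.≤-trans
    (fromℤ-mono-≤ (spread-≤ (a₂₁ φ) (a₂₂ φ) (v₂ φ)
      (proj₁ (V i)) (proj₂ (V i)) (proj₁ (V j)) (proj₂ (V j)) h≤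
      (fromℤ-cancel-≤ (proj₁ (proj₂ (fits-vertex V φ fits j))))))
    (proj₂ (proj₂ (fits-vertex V φ fits i)))

  -- Otherwise V would fit in a box of side h - 1.
  ≤⇒Wide : ∀ {n h} (V : Vector LatticePoint (suc n)) → 1ℤ ≤ h →
    (∀ l → 0ℚ ℚ.≤ l → FitsIn (conv V) l → fromℤ h ℚ.≤ l) → Wide h V
  ≤⇒Wide {h = h} V 1≤h minimal α β γ δ unit
    with narrow-or-spread h V α β | narrow-or-spread h V γ δ
  ... | inj₂ wide      | _              = inj₁ wide
  ... | inj₁ _         | inj₂ wide      = inj₂ wide
  ... | inj₁ (v , box) | inj₁ (w , box′) = contradiction
    (fromℤ-cancel-≤ (minimal (fromℤ (h - 1ℤ)) (fromℤ-mono-≤ (Δ 1≤h))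
      (box-fits V φ (λ i → box i , box′ i))))
    (ℤₚ.<⇒≱ (ℤₚ.i≤pred[j]⇒i<j (ℤₚ.≤-reflexive (ℤₚ.+-comm h -1ℤ))))
    where
    φ : AffineUnimodular
    φ = record { a₁₁ = α ; a₁₂ = β ; a₂₁ = γ ; a₂₂ = δ ; v₁ = v ; v₂ = w ; det≡±1 = unit }

  IsMinimal⇒Minimal : ∀ {h P} → 1ℤ ≤ h → IsMinimal P (fromℤ h) →
    ∃ λ n → ∃ λ (V : Vector LatticePoint (suc n)) →
    P ≐ conv V × Minimal h V × ∃[ φ ] InBox h (act φ ∘ V)
  IsMinimal⇒Minimal {h} {P} 1≤h ((n , V , P⊆V , V⊆P) , (0≤h , (φ , fits) , least-size) , min) =
    n , V , (P⊆V , V⊆P) ,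
    record
      { wide  = ≤⇒Wide V 1≤h (λ l 0≤l (ψ , ψ-fits) → least-size l 0≤l
          (ψ , λ { (p , p∈P , eq) → ψ-fits (p , P⊆V p∈P , eq) }))
      -- The hypothesis only refutes that a vertex is missing from `conv U`; decidability turns this
      -- into membership. The map `φ` that fits `P` fits `conv U` as well.
      ; least = λ {m} U U⊆V U-wide i → decidable-stable (conv? U (ι (V i))) λ Vi∉U →
          min (conv U) (m , U , (λ u → u) , (λ u → u))
            ((λ u → V⊆P (conv-least {U = U} {V = V} U⊆V u)) , λ P⊆U → Vi∉U (P⊆U (V⊆P (conv-vertex V i))))
            (0≤h , (φ , λ { (p , p∈U , eq) → fits (p , V⊆P (conv-least {U = U} {V = V} U⊆V p∈U) , eq) }) ,
              λ l _ U-fits → Wide⇒≤ U U-wide U-fits)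
      } ,
    φ , fits-box V φ (λ { (p , p∈V , eq) → fits (p , V⊆P p∈V , eq) })

  -- Strict inequalities, contradictions and parity over ℤ

  <⇒Δ : ∀ {i j} → i < j → 0ℤ ≤ j - (1ℤ + i)
  <⇒Δ i<j = Δ (ℤₚ.i<j⇒suc[i]≤j i<j)

  <-by : ∀ {i j k} → 0ℤ ≤ k → j - (1ℤ + i) ≡ k → i < j
  <-by 0≤k eq = ℤₚ.suc[i]≤j⇒i<j (≤-by 0≤k eq)

  0≤1 : 0ℤ ≤ 1ℤ
  0≤1 = +≤+ z≤n

  ≤-<-connex : ∀ i j → i ≤ j ⊎ j < i
  ≤-<-connex i j with i ℤₚ.≤? j
  ... | yes i≤j = inj₁ i≤j
  ... | no  i≰j = inj₂ (ℤₚ.≰⇒> i≰j)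

  -- Contradictions are certified like inequalities: known nonnegative differences are combined to
  -- -1.
  absurd : ∀ {A : Set} {k} → 0ℤ ≤ k → k ≡ -1ℤ → A
  absurd 0≤k refl with () ← 0≤k

  ≤-by-half : ∀ {i j k} → 0ℤ ≤ k → (j - i) + (j - i) ≡ k → i ≤ j
  ≤-by-half {i} {j} 0≤k refl with ℤₚ.≤-total i j
  ... | inj₁ i≤j = i≤j
  ... | inj₂ j≤i = ≤-by (0≤k ⊕ Δ j≤i) (solve (i ∷ j ∷ []))

  double-not-unit : ∀ z → ¬ Unit (z + z)
  double-not-unit z (inj₁ eq) with ≤-<-connex z 0ℤ
  ... | inj₁ z≤0 = absurd (Δ z≤0 ⊕ Δ z≤0 ⊕ Δ (ℤₚ.≤-reflexive (sym eq))) (solve (z ∷ []))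
  ... | inj₂ 0<z = absurd (<⇒Δ 0<z ⊕ <⇒Δ 0<z ⊕ Δ (ℤₚ.≤-reflexive eq)) (solve (z ∷ []))
  double-not-unit z (inj₂ eq) with ≤-<-connex 0ℤ z
  ... | inj₁ 0≤z = absurd (Δ 0≤z ⊕ Δ 0≤z ⊕ Δ (ℤₚ.≤-reflexive eq)) (solve (z ∷ []))
  ... | inj₂ z<0 = absurd (<⇒Δ z<0 ⊕ <⇒Δ z<0 ⊕ Δ (ℤₚ.≤-reflexive (sym eq))) (solve (z ∷ []))

  zero-not-unit : ∀ {d} → d ≡ 0ℤ → ¬ Unit d
  zero-not-unit refl (inj₁ ())
  zero-not-unit refl (inj₂ ())

  -- Configurations of few points with lattice size at least `h`

  infix 4 _∈_

  _∈_ : ∀ {n} → LatticePoint → Vector LatticePoint n → Set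
  v ∈ U = ∃[ i ] U i ≡ v

  ∈-act : ∀ {n} {U : Vector LatticePoint n} φ {v w} → act φ v ≡ w → v ∈ U → w ∈ (act φ ∘ U)
  ∈-act φ eq (i , refl) = i , eq

  ∈-conv : ∀ {n} {V : Vector LatticePoint n} {v} → v ∈ V → conv V (ι v)
  ∈-conv {V = V} (i , refl) = conv-vertex V i

  spread-∈ : ∀ {n h a b c d} {U : Vector LatticePoint n} α β → (a , b) ∈ U → (c , d) ∈ U →
    h ≤ α * (a - c) + β * (b - d) → Spread h U α β
  spread-∈ α β (i , refl) (j , refl) h≤ = spread i j h≤

  spread-neg : ∀ {n h} {U : Vector LatticePoint n} α β → Spread h U (- α) (- β) → Spread h U α β
  spread-neg {h = h} {U} α β (spread i j h≤) = spread j i $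
    subst (h ≤_) (swapped α β (proj₁ (U i)) (proj₁ (U j)) (proj₂ (U i)) (proj₂ (U j))) h≤
    where
    swapped : ∀ α β x x′ y y′ → (- α) * (x - x′) + (- β) * (y - y′) ≡ α * (x′ - x) + β * (y′ - y)
    swapped α β x x′ y y′ = solve (α ∷ β ∷ x ∷ x′ ∷ y ∷ y′ ∷ [])

  -- With |β| < α and |d| ≤ h the value is at least (α - |β|) h. The two products add up to twice
  -- the difference, which spares a case split on the sign of `β`.
  dominant : ∀ α β h d → d ≤ h → - h ≤ d → β < α → - β < α → h ≤ α * h + β * d
  dominant α β h d d≤h -h≤d β<α -β<α =
    ≤-by-half (<⇒Δ β<α ⊗ Δ d≤h ⊕ <⇒Δ -β<α ⊗ Δ -h≤d) (solve (α ∷ β ∷ h ∷ d ∷ []))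

  module Frame {n h} {U : Vector LatticePoint n} {p q r s}
    (L : (0ℤ , p) ∈ U) (R : (h , q) ∈ U) (S : (r , 0ℤ) ∈ U) (T : (s , h) ∈ U)
    (p-range : 0ℤ ≤ p × p ≤ h) (q-range : 0ℤ ≤ q × q ≤ h)
    (r-range : 0ℤ ≤ r × r ≤ h) (s-range : 0ℤ ≤ s × s ≤ h) where

    private
      difference-≤ : ∀ {y z} → 0ℤ ≤ y × y ≤ h → 0ℤ ≤ z × z ≤ h → z - y ≤ h
      difference-≤ {y} {z} (0≤y , _) (_ , z≤h) = ≤-by (0≤y ⊕ Δ z≤h) (solve (h ∷ y ∷ z ∷ []))

      ≤-difference : ∀ {y z} → 0ℤ ≤ y × y ≤ h → 0ℤ ≤ z × z ≤ h → - h ≤ z - y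
      ≤-difference {y} {z} (_ , y≤h) (0≤z , _) = ≤-by (0≤z ⊕ Δ y≤h) (solve (h ∷ y ∷ z ∷ []))

      q-p≤h : q - p ≤ h
      q-p≤h = difference-≤ p-range q-range

      -h≤q-p : - h ≤ q - p
      -h≤q-p = ≤-difference p-range q-range

      s-r≤h : s - r ≤ h
      s-r≤h = difference-≤ r-range s-range

      -h≤s-r : - h ≤ s - r
      -h≤s-r = ≤-difference r-range s-range

      exchange : ∀ α β d → β * h + α * d ≡ α * d + β * (h - 0ℤ)
      exchange α β d = solve (α ∷ β ∷ h ∷ d ∷ [])

    -- The coefficient of larger absolute value selects the pair: left and right for `α`, bottom and
    -- top for `β`. The other coordinate of the pair differs by at most `h`, so `dominant` applies.
    balanced-or-spread : ∀ α β → (α ≡ β ⊎ α ≡ - β) ⊎ Spread h U α β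
    balanced-or-spread α β with ℤₚ.<-cmp α β | ℤₚ.<-cmp α (- β)
    ... | tri≈ _ eq _ | _           = inj₁ (inj₁ eq)
    ... | _           | tri≈ _ eq _ = inj₁ (inj₂ eq)
    ... | tri> _ _ β<α | tri> _ _ -β<α = inj₂ (spread-∈ α β R L
      (subst (λ z → h ≤ α * z + β * (q - p)) (sym (ℤₚ.+-identityʳ h))
        (dominant α β h (q - p) q-p≤h -h≤q-p β<α -β<α)))
    ... | tri< α<β _ _ | tri< α<-β _ _ = inj₂ (spread-neg α β (spread-∈ (- α) (- β) R L
      (subst (λ z → h ≤ (- α) * z + (- β) * (q - p)) (sym (ℤₚ.+-identityʳ h))
        (dominant (- α) (- β) h (q - p) q-p≤h -h≤q-p (ℤₚ.neg-mono-< α<β) (ℤₚ.neg-mono-< α<-β)))))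
    ... | tri< α<β _ _ | tri> _ _ -β<α = inj₂ (spread-∈ α β T S (subst (h ≤_) (exchange α β (s - r))
      (dominant β α h (s - r) s-r≤h -h≤s-r α<β (subst (- α <_) (ℤₚ.neg-involutive β) (ℤₚ.neg-mono-< -β<α)))))
    ... | tri> _ _ β<α | tri< α<-β _ _ = inj₂ (spread-neg α β (spread-∈ (- α) (- β) T S
      (subst (h ≤_) (exchange (- α) (- β) (s - r))
      (dominant (- β) (- α) h (s - r) s-r≤h -h≤s-r (ℤₚ.neg-mono-< β<α)
        (subst (_< - β) (sym (ℤₚ.neg-involutive α)) α<-β)))))

    -- Two vectors of the form (α , ±α) have an even determinant.
    Wide-frame : Wide h U
    Wide-frame α β γ δ unit with balanced-or-spread α β | balanced-or-spread γ δ
    ... | inj₂ wide | _         = inj₁ wide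
    ... | inj₁ _    | inj₂ wide = inj₂ wide
    ... | inj₁ (inj₁ refl) | inj₁ (inj₁ refl) = ⊥-elim (zero-not-unit (eq α γ) unit)
      where
      eq : ∀ α γ → α * γ - α * γ ≡ 0ℤ
      eq α γ = solve (α ∷ γ ∷ [])
    ... | inj₁ (inj₁ refl) | inj₁ (inj₂ refl) = ⊥-elim (double-not-unit (α * δ) (subst Unit (eq α δ) unit))
      where
      eq : ∀ α δ → α * δ - α * (- δ) ≡ α * δ + α * δ
      eq α δ = solve (α ∷ δ ∷ [])
    ... | inj₁ (inj₂ refl) | inj₁ (inj₁ refl) = ⊥-elim (double-not-unit (- (β * γ)) (subst Unit (eq β γ) unit))
      where
      eq : ∀ β γ → (- β) * γ - β * γ ≡ (- (β * γ)) + (- (β * γ))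
      eq β γ = solve (β ∷ γ ∷ [])
    ... | inj₁ (inj₂ refl) | inj₁ (inj₂ refl) = ⊥-elim (zero-not-unit (eq β δ) unit)
      where
      eq : ∀ β δ → (- β) * δ - β * (- δ) ≡ 0ℤ
      eq β δ = solve (β ∷ δ ∷ [])

  open Frame public using (Wide-frame)

  module Slanted {n h} {U : Vector LatticePoint n} {p q a b c d}
    (0≤h : 0ℤ ≤ h) (L : (0ℤ , p) ∈ U) (R : (h , q) ∈ U) (A : (a , b) ∈ U) (B : (c , d) ∈ U)
    (q≤p : q ≤ p) (p-q≤h : p ≤ q + h) (h≤AB : h ≤ (a - c) + (b - d)) (a-c≤h : a - c ≤ h) where

    private
      steep : ∀ α β → 0ℤ < α → α ≤ β → h ≤ α * (a - c) + β * (b - d)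
      steep α β 0<α α≤β = ≤-by
        ((0≤1 ⊕ <⇒Δ 0<α) ⊗ Δ h≤AB ⊕ <⇒Δ 0<α ⊗ 0≤h ⊕ Δ α≤β ⊗ (Δ h≤AB ⊕ Δ a-c≤h))
        (solve (α ∷ β ∷ h ∷ a ∷ b ∷ c ∷ d ∷ []))

      gentle : ∀ α β → 0ℤ ≤ β → β < α → h ≤ α * (h - 0ℤ) + β * (q - p)
      gentle α β 0≤β β<α = ≤-by (<⇒Δ β<α ⊗ 0≤h ⊕ 0≤β ⊗ Δ p-q≤h)
        (solve (α ∷ β ∷ h ∷ p ∷ q ∷ []))

      falling : ∀ α β → 0ℤ < α → β ≤ 0ℤ → h ≤ α * (h - 0ℤ) + β * (q - p)
      falling α β 0<α β≤0 = ≤-by (<⇒Δ 0<α ⊗ 0≤h ⊕ Δ β≤0 ⊗ Δ q≤p)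
        (solve (α ∷ β ∷ h ∷ p ∷ q ∷ []))

    -- The pair `R`, `L` serves for β < α, since q - p lies between -h and 0. For α ≤ β the pair
    -- `A`, `B` serves: its levels differ by at least `h`, and b - d ≥ 0 because a - c ≤ h.
    spread-positive : ∀ α β → 0ℤ < α → Spread h U α β
    spread-positive α β 0<α with ≤-<-connex α β
    ... | inj₁ α≤β = spread-∈ α β A B (steep α β 0<α α≤β)
    ... | inj₂ β<α with ℤₚ.≤-total β 0ℤ
    ...   | inj₁ β≤0 = spread-∈ α β R L (falling α β 0<α β≤0)
    ...   | inj₂ 0≤β = spread-∈ α β R L (gentle α β 0≤β β<α)

    spread-nonzero : ∀ α β → α ≡ 0ℤ ⊎ Spread h U α β
    spread-nonzero α β with ℤₚ.<-cmp α 0ℤ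
    ... | tri< α<0 _ _ = inj₂ (spread-neg α β (spread-positive (- α) (- β) (ℤₚ.neg-mono-< α<0)))
    ... | tri≈ _ α≡0 _ = inj₁ α≡0
    ... | tri> _ _ 0<α = inj₂ (spread-positive α β 0<α)

    -- Only directions with first coefficient 0 can fail, and two of these have determinant 0.
    Wide-slanted : Wide h U
    Wide-slanted α β γ δ unit with spread-nonzero α β | spread-nonzero γ δ
    ... | inj₂ wide | _         = inj₁ wide
    ... | inj₁ _    | inj₂ wide = inj₂ wide
    ... | inj₁ refl | inj₁ refl = ⊥-elim (zero-not-unit (eq β δ) unit)
      where
      eq : ∀ β δ → 0ℤ * δ - β * 0ℤ ≡ 0ℤ
      eq β δ = solve (β ∷ δ ∷ [])

  open Slanted public using (Wide-slanted)

  module Segment {n h} {U : Vector LatticePoint n} {x y e f u v}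
    (0≤h : 0ℤ ≤ h) (X : (x , y) ∈ U) (Y : (x + h * e , y + h * f) ∈ U)
    (unimodular : u * e + v * f ≡ 1ℤ) where

    private
      forth : ∀ α β x y e f →
        h * (α * e + β * f) ≡ α * ((x + h * e) - x) + β * ((y + h * f) - y)
      forth α β x y e f = solve (h ∷ α ∷ β ∷ x ∷ y ∷ e ∷ f ∷ [])

      back : ∀ α β x y e f →
        h * (- (α * e + β * f)) ≡ α * (x - (x + h * e)) + β * (y - (y + h * f))
      back α β x y e f = solve (h ∷ α ∷ β ∷ x ∷ y ∷ e ∷ f ∷ [])

      stretch : ∀ {m} → 0ℤ < m → h ≤ h * m
      stretch {m} 0<m = ≤-by (0≤h ⊗ <⇒Δ 0<m) (solve (h ∷ m ∷ []))

    -- The direction takes values at the two points that differ by `h` times an integer, so it is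
    -- enough that this integer is not 0.
    spread-nonzero : ∀ α β → α * e + β * f ≡ 0ℤ ⊎ Spread h U α β
    spread-nonzero α β with ℤₚ.<-cmp 0ℤ (α * e + β * f)
    ... | tri< 0<m _ _ = inj₂ (spread-∈ α β Y X (subst (h ≤_) (forth α β x y e f) (stretch 0<m)))
    ... | tri≈ _ 0≡m _ = inj₁ (sym 0≡m)
    ... | tri> _ _ m<0 = inj₂ (spread-∈ α β X Y
      (subst (h ≤_) (back α β x y e f) (stretch (ℤₚ.neg-mono-< m<0))))

    -- Since (e, f) is primitive, Cramer's rule writes the determinant as an integer combination of
    -- the values of both directions on (e, f); these cannot both vanish.
    Wide-segment : Wide h U
    Wide-segment α β γ δ unit with spread-nonzero α β | spread-nonzero γ δ
    ... | inj₂ wide | _         = inj₁ wide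
    ... | inj₁ _    | inj₂ wide = inj₂ wide
    ... | inj₁ m≡0  | inj₁ k≡0  = ⊥-elim (zero-not-unit det≡0 unit)
      where
      cramer : (α * δ - β * γ) * (u * e + v * f) ≡
        (u * δ - v * γ) * (α * e + β * f) + (v * α - u * β) * (γ * e + δ * f)
      cramer = solve (α ∷ β ∷ γ ∷ δ ∷ e ∷ f ∷ u ∷ v ∷ [])
      collapse : ∀ m k → m * 0ℤ + k * 0ℤ ≡ 0ℤ
      collapse m k = solve (m ∷ k ∷ [])
      det≡0 : α * δ - β * γ ≡ 0ℤ
      det≡0 = trans (sym (ℤₚ.*-identityʳ _)) (trans (cong ((α * δ - β * γ) *_) (sym unimodular))
        (trans cramer (trans (cong₂ (λ m k → (u * δ - v * γ) * m + (v * α - u * β) * k) m≡0 k≡0)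
          (collapse (u * δ - v * γ) (v * α - u * β)))))

  open Segment public using (Wide-segment)

  -- Barycentric coordinates with the common denominator u + v + w, so that membership is reduced to
  -- identities over ℤ.
  conv-triangle : ∀ {a b c : LatticePoint} u v w x y →
    0ℤ ≤ u → 0ℤ ≤ v → 0ℤ ≤ w → 0ℤ < u + v + w →
    u * proj₁ a + v * proj₁ b + w * proj₁ c ≡ (u + v + w) * x →
    u * proj₂ a + v * proj₂ b + w * proj₂ c ≡ (u + v + w) * y →
    conv (a Vec.∷ b Vec.∷ c Vec.∷ Vec.[]) (ι (x , y))
  conv-triangle {a} {b} {c} u v w x y 0≤u 0≤v 0≤w 0<D eqx eqy =
    t , (λ { zero → weight 0≤u ; (suc zero) → weight 0≤v ; (suc (suc zero)) → weight 0≤w }) ,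
    trans (sum′ (fromℤ u) (fromℤ v) (fromℤ w) r)
      (trans (cong (ℚ._* r) (sym (homo₃ u v w))) (ℚₚ.*-inverseʳ D)) ,
    combine (proj₁ a) (proj₁ b) (proj₁ c) x eqx , combine (proj₂ a) (proj₂ b) (proj₂ c) y eqy
    where
    D : ℚ
    D = fromℤ (u + v + w)
    instance
      D-pos : ℚ.Positive D
      D-pos = positive 0<D
      D-nonZero : ℚ.NonZero D
      D-nonZero = ℚₚ.pos⇒nonZero D
    r : ℚ
    r = ℚ.1/ D
    r≥0 : 0ℚ ℚ.≤ r
    r≥0 = ℚₚ.<⇒≤ (ℚₚ.positive⁻¹ r {{ℚₚ.1/pos⇒pos D}})
    t : Vector ℚ 3
    t = (fromℤ u ℚ.* r) Vec.∷ (fromℤ v ℚ.* r) Vec.∷ (fromℤ w ℚ.* r) Vec.∷ Vec.[]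
    weight : ∀ {k} → 0ℤ ≤ k → 0ℚ ℚ.≤ fromℤ k ℚ.* r
    weight 0≤k = *-nonNeg (fromℤ-mono-≤ 0≤k) r≥0
    homo₃ : ∀ i j k → fromℤ (i + j + k) ≡ fromℤ i ℚ.+ fromℤ j ℚ.+ fromℤ k
    homo₃ i j k = trans (fromℤ-homo-+ (i + j) k) (cong (ℚ._+ fromℤ k) (fromℤ-homo-+ i j))
    sum′ : ∀ p q s r → p ℚ.* r ℚ.+ (q ℚ.* r ℚ.+ (s ℚ.* r ℚ.+ 0ℚ)) ≡ (p ℚ.+ q ℚ.+ s) ℚ.* r
    sum′ p q s r = solve-in (p ∷ q ∷ s ∷ r ∷ []) ℚ-ring
    gather : ∀ p q s r A B C →
      p ℚ.* r ℚ.* A ℚ.+ (q ℚ.* r ℚ.* B ℚ.+ (s ℚ.* r ℚ.* C ℚ.+ 0ℚ)) ≡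
      r ℚ.* (p ℚ.* A ℚ.+ q ℚ.* B ℚ.+ s ℚ.* C)
    gather p q s r A B C = solve-in (p ∷ q ∷ s ∷ r ∷ A ∷ B ∷ C ∷ []) ℚ-ring
    combine : ∀ i j k z → u * i + v * j + w * k ≡ (u + v + w) * z →
      fromℤ u ℚ.* r ℚ.* fromℤ i ℚ.+ (fromℤ v ℚ.* r ℚ.* fromℤ j ℚ.+
        (fromℤ w ℚ.* r ℚ.* fromℤ k ℚ.+ 0ℚ)) ≡ fromℤ z
    combine i j k z eq = begin
      _ ≡⟨ gather (fromℤ u) (fromℤ v) (fromℤ w) r (fromℤ i) (fromℤ j) (fromℤ k) ⟩
      r ℚ.* (fromℤ u ℚ.* fromℤ i ℚ.+ fromℤ v ℚ.* fromℤ j ℚ.+ fromℤ w ℚ.* fromℤ k)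
        ≡⟨ cong (r ℚ.*_) (cong₂ ℚ._+_ (cong₂ ℚ._+_ (fromℤ-homo-* u i) (fromℤ-homo-* v j)) (fromℤ-homo-* w k)) ⟨
      r ℚ.* (fromℤ (u * i) ℚ.+ fromℤ (v * j) ℚ.+ fromℤ (w * k)) ≡⟨ cong (r ℚ.*_) (homo₃ (u * i) (v * j) (w * k)) ⟨
      r ℚ.* fromℤ (u * i + v * j + w * k) ≡⟨ cong (λ e → r ℚ.* fromℤ e) eq ⟩
      r ℚ.* fromℤ ((u + v + w) * z) ≡⟨ cong (r ℚ.*_) (fromℤ-homo-* (u + v + w) z) ⟩
      r ℚ.* (D ℚ.* fromℤ z) ≡⟨ ℚₚ.*-assoc r D (fromℤ z) ⟨
      r ℚ.* D ℚ.* fromℤ z ≡⟨ cong (ℚ._* fromℤ z) (ℚₚ.*-inverseˡ D) ⟩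
      1ℚ ℚ.* fromℤ z ≡⟨ ℚₚ.*-identityˡ (fromℤ z) ⟩
      fromℤ z ∎
      where open ≡-Reasoning

  conv-≃ : ∀ {m n} φ {V : Vector LatticePoint n} {U W : Vector LatticePoint m} →
    (∀ j → conv V (ι (U j))) → (∀ i → conv U (ι (V i))) → (∀ j → act φ (U j) ≡ W j) →
    conv V ≃ conv W
  conv-≃ φ {V} {U} {W} U⊆V V⊆U φU≗W = φ ,
    (λ p∈ → conv-resp φU≗W (conv-least {U = act φ ∘ V} {V = act φ ∘ U}
      (λ i → conv-act φ U (V⊆U i)) (proj₁ (conv-map φ V) p∈))) ,
    (λ q∈ → proj₂ (conv-map φ V) (conv-least {U = act φ ∘ U} {V = act φ ∘ V}
      (λ j → conv-act φ V (U⊆V j)) (conv-resp (λ j → sym (φU≗W j)) q∈)))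

  -- Symmetries of the box

  affine : ∀ a b c d v w → Unit (a * d - b * c) → AffineUnimodular
  affine a b c d v w unit = record
    { a₁₁ = a ; a₁₂ = b ; a₂₁ = c ; a₂₂ = d ; v₁ = v ; v₂ = w ; det≡±1 = unit }

  transpose : AffineUnimodular
  transpose = affine 0ℤ 1ℤ 1ℤ 0ℤ 0ℤ 0ℤ (inj₂ refl)

  reflect rotate : ℤ → AffineUnimodular
  reflect h = affine 1ℤ 0ℤ 0ℤ -1ℤ 0ℤ h (inj₂ refl)
  rotate  h = affine -1ℤ 0ℤ 0ℤ -1ℤ h h (inj₁ refl)

  -- The new ordinate is the level x + y, counted downwards from `m`. The sign is chosen so that the
  -- point on the right side is again not higher than the one on the left, as `framed` requires.
  shear : ℤ → AffineUnimodular
  shear m = affine 1ℤ 0ℤ -1ℤ -1ℤ 0ℤ m (inj₂ refl)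

  private
    fst-coordinate : ∀ x y → (1ℤ * x + 0ℤ * y) + 0ℤ ≡ x
    fst-coordinate x y = solve (x ∷ y ∷ [])

    snd-coordinate : ∀ x y → (0ℤ * x + 1ℤ * y) + 0ℤ ≡ y
    snd-coordinate x y = solve (x ∷ y ∷ [])

    co-fst-coordinate : ∀ h x y → (-1ℤ * x + 0ℤ * y) + h ≡ h - x
    co-fst-coordinate h x y = solve (h ∷ x ∷ y ∷ [])

    co-snd-coordinate : ∀ h x y → (0ℤ * x + -1ℤ * y) + h ≡ h - y
    co-snd-coordinate h x y = solve (h ∷ x ∷ y ∷ [])

    co-level : ∀ m x y → (-1ℤ * x + -1ℤ * y) + m ≡ m - (x + y)
    co-level m x y = solve (m ∷ x ∷ y ∷ [])

  act-transpose : ∀ x y → act transpose (x , y) ≡ (y , x)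
  act-transpose x y = cong₂ _,_ (snd-coordinate x y) (fst-coordinate x y)

  act-reflect : ∀ h x y → act (reflect h) (x , y) ≡ (x , h - y)
  act-reflect h x y = cong₂ _,_ (fst-coordinate x y) (co-snd-coordinate h x y)

  act-rotate : ∀ h x y → act (rotate h) (x , y) ≡ (h - x , h - y)
  act-rotate h x y = cong₂ _,_ (co-fst-coordinate h x y) (co-snd-coordinate h x y)

  act-shear : ∀ m x y → act (shear m) (x , y) ≡ (x , m - (x + y))
  act-shear m x y = cong₂ _,_ (fst-coordinate x y) (co-level m x y)

  Within : ℤ → LatticePoint → Set
  Within h (x , y) = (0ℤ ≤ x × x ≤ h) × (0ℤ ≤ y × y ≤ h)

  box-∈ : ∀ {n h v} {V : Vector LatticePoint n} → InBox h V → v ∈ V → Within h v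
  box-∈ box (i , refl) = box i

  box-act : ∀ {n h} φ {V : Vector LatticePoint n} (f : LatticePoint → LatticePoint) →
    (∀ v → act φ v ≡ f v) → (∀ i → Within h (f (V i))) → InBox h (act φ ∘ V)
  box-act {h = h} φ {V} f eq within i = subst (Within h) (sym (eq (V i))) (within i)

  complement : ∀ {h z} → 0ℤ ≤ z × z ≤ h → 0ℤ ≤ h - z × h - z ≤ h
  complement {h} {z} (0≤z , z≤h) = Δ z≤h , ≤-by 0≤z (solve (h ∷ z ∷ []))

  box-rotate : ∀ {n h} {V : Vector LatticePoint n} → InBox h V → InBox h (act (rotate h) ∘ V)
  box-rotate {h = h} {V} box = box-act (rotate h) (λ (x , y) → h - x , h - y) (λ (x , y) → act-rotate h x y)
    (λ i → complement (proj₁ (box i)) , complement (proj₂ (box i)))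

  box-reflect : ∀ {n h} {V : Vector LatticePoint n} → InBox h V → InBox h (act (reflect h) ∘ V)
  box-reflect {h = h} {V} box = box-act (reflect h) (λ (x , y) → x , h - y) (λ (x , y) → act-reflect h x y)
    (λ i → proj₁ (box i) , complement (proj₂ (box i)))

  box-transpose : ∀ {n h} {V : Vector LatticePoint n} → InBox h V → InBox h (act transpose ∘ V)
  box-transpose {h = h} {V} box = box-act transpose (λ (x , y) → y , x) (λ (x , y) → act-transpose x y)
    (λ i → proj₂ (box i) , proj₁ (box i))

  -- If (c , d) lies below the segment from (0 , p) to (h , q), then (c , 1 + d)
  -- still lies in the triangle they span, as -1 ≤ (q - p) / h ≤ 0.
  raise : ∀ {h p q c d} → 0ℤ < h → q ≤ p → p ≤ q + h → 0ℤ ≤ c → c ≤ h → c + d < p →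
    conv ((0ℤ , p) Vec.∷ (h , q) Vec.∷ (c , d) Vec.∷ Vec.[]) (ι (c , 1ℤ + d))
  raise {h} {p} {q} {c} {d} 0<h q≤p p≤q+h 0≤c c≤h c+d<p =
    -- The first two weights give the point of the segment with abscissa `c`. The third is `h` times
    -- the height of that point above `(c , 1ℤ + d)`, which `slack` shows to be nonnegative.
    conv-triangle (h - c) c (p * h + c * (q - p) - h * d - h) c (1ℤ + d)
      (Δ c≤h) 0≤c (subst (0ℤ ≤_) slack (0≤c ⊗ Δ p≤q+h ⊕ ℤₚ.<⇒≤ 0<h ⊗ <⇒Δ c+d<p))
      (subst (0ℤ <_) total (ℤₚ.+-mono-<-≤ 0<h (0≤c ⊗ Δ p≤q+h ⊕ ℤₚ.<⇒≤ 0<h ⊗ <⇒Δ c+d<p)))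
      abscissa ordinate
    where
    abscissa : (h - c) * 0ℤ + c * h + (p * h + c * (q - p) - h * d - h) * c ≡
      (h - c + c + (p * h + c * (q - p) - h * d - h)) * c
    abscissa = solve (h ∷ p ∷ q ∷ c ∷ d ∷ [])
    ordinate : (h - c) * p + c * q + (p * h + c * (q - p) - h * d - h) * d ≡
      (h - c + c + (p * h + c * (q - p) - h * d - h)) * (1ℤ + d)
    ordinate = solve (h ∷ p ∷ q ∷ c ∷ d ∷ [])
    slack : c * (q + h - p) + h * (p - (1ℤ + (c + d))) ≡ p * h + c * (q - p) - h * d - h
    slack = solve (h ∷ p ∷ q ∷ c ∷ d ∷ [])
    total : h + (c * (q + h - p) + h * (p - (1ℤ + (c + d)))) ≡
      h - c + c + (p * h + c * (q - p) - h * d - h)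
    total = solve (h ∷ p ∷ q ∷ c ∷ d ∷ [])

  least-∈ : ∀ {m n h v} {V : Vector LatticePoint (suc n)} → Minimal h V →
    (U : Vector LatticePoint (suc m)) → (∀ j → conv V (ι (U j))) → Wide h U →
    v ∈ V → conv U (ι v)
  least-∈ min U U⊆V wide (i , eq) = subst (λ v → conv U (ι v)) eq (least min U U⊆V wide i)

  -- Otherwise raising the vertex (c , d) by one gives a smaller polygon of the
  -- same lattice size.
  level-bound-low : ∀ {n h p q a b c d} {V : Vector LatticePoint (suc n)} → 0ℤ < h →
    Minimal h V → InBox h V → (0ℤ , p) ∈ V → (h , q) ∈ V → q ≤ p →
    (a , b) ∈ V → (c , d) ∈ V → c + d < p → (a + b) - (c + d) ≤ h
  level-bound-low {n} {h} {p} {q} {a} {b} {c} {d} {V} 0<h min box L R q≤p A B c+d<p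
    with ≤-<-connex ((a + b) - (c + d)) h
  ... | inj₁ bounded = bounded
  ... | inj₂ h<AB    = absurd (Δ above) (solve (c ∷ d ∷ []))
    where
    U : Vector LatticePoint 4
    U = (0ℤ , p) Vec.∷ (h , q) Vec.∷ (a , b) Vec.∷ (c , 1ℤ + d) Vec.∷ Vec.[]
    within-A = box-∈ box A
    within-B = box-∈ box B
    p≤q+h : p ≤ q + h
    p≤q+h = ≤-by (proj₁ (proj₂ (box-∈ box R)) ⊕ Δ (proj₂ (proj₂ (box-∈ box L)))) (solve (p ∷ q ∷ h ∷ []))
    raised : conv V (ι (c , 1ℤ + d))
    raised = conv-least {U = (0ℤ , p) Vec.∷ (h , q) Vec.∷ (c , d) Vec.∷ Vec.[]} {V = V}
      (λ { 0F → ∈-conv L ; 1F → ∈-conv R ; 2F → ∈-conv B })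
      (raise 0<h q≤p p≤q+h (proj₁ (proj₁ within-B)) (proj₂ (proj₁ within-B)) c+d<p)
    U⊆V : ∀ j → conv V (ι (U j))
    U⊆V 0F = ∈-conv L
    U⊆V 1F = ∈-conv R
    U⊆V 2F = ∈-conv A
    U⊆V 3F = raised
    -- The excess over `h` is at least 1 by integrality, exactly what raising `(c , d)` costs.
    h≤AB′ : h ≤ (a - c) + (b - (1ℤ + d))
    h≤AB′ = ≤-by (<⇒Δ h<AB) (solve (h ∷ a ∷ b ∷ c ∷ d ∷ []))
    a-c≤h : a - c ≤ h
    a-c≤h = ≤-by (Δ (proj₂ (proj₁ within-A)) ⊕ proj₁ (proj₁ within-B)) (solve (h ∷ a ∷ c ∷ []))
    U-wide : Wide h U
    U-wide = Wide-slanted {U = U} (ℤₚ.<⇒≤ 0<h) (0F , refl) (1F , refl) (2F , refl) (3F , refl)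
      q≤p p≤q+h h≤AB′ a-c≤h
    coordinate-sum : ∀ {m} x y → m ≤ x + y → m ≤ 1ℤ * x + 1ℤ * y
    coordinate-sum x y = subst₂ _≤_ refl
      (sym (cong₂ _+_ (ℤₚ.*-identityˡ x) (ℤₚ.*-identityˡ y)))
    -- All of `U` has level above c + d: `(h , q)` because h + q ≥ p, and `(a , b)` by the assumed
    -- excess. So `(c , d)` is outside the hull of `U`, against minimality.
    above-U : ∀ j → 1ℤ + (c + d) ≤ 1ℤ * proj₁ (U j) + 1ℤ * proj₂ (U j)
    above-U 0F = coordinate-sum 0ℤ p (≤-by (<⇒Δ c+d<p) (solve (c ∷ d ∷ p ∷ [])))
    above-U 1F = coordinate-sum h q (≤-by (<⇒Δ c+d<p ⊕ Δ p≤q+h) (solve (c ∷ d ∷ p ∷ q ∷ h ∷ [])))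
    above-U 2F = coordinate-sum a b (≤-by (<⇒Δ h<AB ⊕ ℤₚ.<⇒≤ 0<h) (solve (a ∷ b ∷ c ∷ d ∷ h ∷ [])))
    above-U 3F = coordinate-sum c (1ℤ + d) (≤-by ℤₚ.≤-refl (solve (c ∷ d ∷ [])))
    above : 1ℤ + (c + d) ≤ 1ℤ * c + 1ℤ * d
    above = conv-bound U 1ℤ 1ℤ (1ℤ + (c + d)) above-U (c , d) (least-∈ min U U⊆V U-wide B)

  -- If the lower point is not below level p and the upper one not above level h + q, the difference
  -- is at most h + q - p ≤ h. Otherwise one of them can be moved inwards; the half-turn of the box
  -- reduces the upper point to the lower one.
  level-bound : ∀ {n h p q a b c d} {V : Vector LatticePoint (suc n)} → 0ℤ < h →
    Minimal h V → InBox h V → (0ℤ , p) ∈ V → (h , q) ∈ V → q ≤ p →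
    (a , b) ∈ V → (c , d) ∈ V → (a + b) - (c + d) ≤ h
  level-bound {n} {h} {p} {q} {a} {b} {c} {d} {V} 0<h min box L R q≤p A B
    with ≤-<-connex p (c + d) | ≤-<-connex (a + b) (h + q)
  ... | inj₂ c+d<p | _          = level-bound-low 0<h min box L R q≤p A B c+d<p
  ... | inj₁ p≤c+d | inj₁ a+b≤h+q = ≤-by (Δ a+b≤h+q ⊕ Δ p≤c+d ⊕ Δ q≤p)
    (solve (h ∷ p ∷ q ∷ a ∷ b ∷ c ∷ d ∷ []))
  ... | inj₁ _     | inj₂ h+q<a+b = subst (_≤ h) levels
    (level-bound-low 0<h (Minimal-act (rotate h) min) (box-rotate box)
      (∈-act (rotate h) (trans (act-rotate h h q) (cong (_, h - q) (ℤₚ.+-inverseʳ h))) R)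
      (∈-act (rotate h) (trans (act-rotate h 0ℤ p) (cong (_, h - p) (ℤₚ.+-identityʳ h))) L)
      (ℤₚ.+-monoʳ-≤ h (ℤₚ.neg-mono-≤ q≤p))
      (∈-act (rotate h) (act-rotate h c d) B) (∈-act (rotate h) (act-rotate h a b) A)
      lowered)
    where
    lowered : (h - a) + (h - b) < h - q
    lowered = <-by (<⇒Δ h+q<a+b) (solve (h ∷ q ∷ a ∷ b ∷ []))
    levels : ((h - c) + (h - d)) - ((h - a) + (h - b)) ≡ (a + b) - (c + d)
    levels = solve (h ∷ a ∷ b ∷ c ∷ d ∷ [])

  -- The three types of minimal polygons

  Classified : ℤ → Region → Set
  Classified h P =
    P ≃ conv ((0ℤ , 0ℤ) Vec.∷ (h , 0ℤ) Vec.∷ Vec.[])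
    ⊎ (∃[ a ] ∃[ b ]
        (1ℤ ≤ a × a ≤ h - 1ℤ) × (1ℤ ≤ b × b ≤ h - 1ℤ) ×
        h ≤ a + b ×
        P ≃ conv ((0ℤ , 0ℤ) Vec.∷ (a , h) Vec.∷ (h , b) Vec.∷ Vec.[]))
    ⊎ (∃[ a ] ∃[ b ] ∃[ c ] ∃[ d ]
        (1ℤ ≤ a × a ≤ h - 1ℤ) × (1ℤ ≤ b × b ≤ h - 1ℤ) ×
        (1ℤ ≤ c × c ≤ h - 1ℤ) × (1ℤ ≤ d × d ≤ h - 1ℤ) ×
        h < (a ⊓ b) + (c ⊓ d) ×
        P ≃ conv ((a , 0ℤ) Vec.∷ (0ℤ , b) Vec.∷ (h , h - c) Vec.∷ (h - d , h) Vec.∷ Vec.[]))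

  Classified-map : ∀ {h P P′} → (∀ {Q} → P′ ≃ Q → P ≃ Q) →
    Classified h P′ → Classified h P
  Classified-map f (inj₁ eq) = inj₁ (f eq)
  Classified-map f (inj₂ (inj₁ (a , b , ra , rb , h≤a+b , eq))) =
    inj₂ (inj₁ (a , b , ra , rb , h≤a+b , f eq))
  Classified-map f (inj₂ (inj₂ (a , b , c , d , ra , rb , rc , rd , h< , eq))) =
    inj₂ (inj₂ (a , b , c , d , ra , rb , rc , rd , h< , f eq))

  Classified-act : ∀ {n h} {V : Vector LatticePoint n} φ →
    Classified h (conv (act φ ∘ V)) → Classified h (conv V)
  Classified-act {V = V} φ = Classified-map (≃-pullback {V = V} φ)

  Interior : ℤ → ℤ → Set
  Interior h z = 1ℤ ≤ z × z ≤ h - 1ℤ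

  endpoint : ∀ {h z} → 0ℤ ≤ z × z ≤ h → z ≡ 0ℤ ⊎ z ≡ h ⊎ Interior h z
  endpoint {h} {z} (0≤z , z≤h) with ℤₚ.<-cmp 0ℤ z | ℤₚ.<-cmp z h
  ... | tri< _ _ _   | tri≈ _ eq _  = inj₂ (inj₁ eq)
  ... | tri< 0<z _ _ | tri< z<h _ _ = inj₂ (inj₂ (ℤₚ.i<j⇒suc[i]≤j 0<z , ≤-by (<⇒Δ z<h) (solve (h ∷ z ∷ []))))
  ... | tri< _ _ _   | tri> _ _ h<z = ⊥-elim (ℤₚ.<⇒≱ h<z z≤h)
  ... | tri≈ _ eq _  | _            = inj₁ (sym eq)
  ... | tri> _ _ z<0 | _            = ⊥-elim (ℤₚ.<⇒≱ z<0 0≤z)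

  interior-complement : ∀ {h z} → Interior h z → Interior h (h - z)
  interior-complement {h} {z} (1≤z , z≤h-1) =
    ≤-by (Δ z≤h-1) (solve (h ∷ z ∷ [])) , ≤-by (Δ 1≤z) (solve (h ∷ z ∷ []))

  -- Two points at `h` times a primitive vector already have lattice size at least `h`, so
  -- minimality leaves only their segment. The rows (u, v) and (-f, e) send (e, f) to (1, 0).
  segment-≃ : ∀ {n h x y x′ y′} {V : Vector LatticePoint (suc n)} e f u v → 0ℤ < h → Minimal h V →
    (x , y) ∈ V → (x′ , y′) ∈ V → x′ ≡ x + h * e → y′ ≡ y + h * f → u * e + v * f ≡ 1ℤ →
    conv V ≃ conv ((0ℤ , 0ℤ) Vec.∷ (h , 0ℤ) Vec.∷ Vec.[])
  segment-≃ {n} {h} {x} {y} {V = V} e f u v 0<h min X Y refl refl uv =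
    conv-≃ φ {U = U} U⊆V
      (least min U U⊆V (Wide-segment {U = U} {u = u} {v} (ℤₚ.<⇒≤ 0<h) (0F , refl) (1F , refl) uv)) φU
    where
    U : Vector LatticePoint 2
    U = (x , y) Vec.∷ (x + h * e , y + h * f) Vec.∷ Vec.[]
    U⊆V : ∀ j → conv V (ι (U j))
    U⊆V 0F = ∈-conv X
    U⊆V 1F = ∈-conv Y
    det-eq : u * e + v * f ≡ u * e - v * (- f)
    det-eq = solve (u ∷ v ∷ e ∷ f ∷ [])
    φ : AffineUnimodular
    φ = affine u v (- f) e (- (u * x + v * y)) (- ((- f) * x + e * y)) (inj₁ (trans (sym det-eq) uv))
    start : ∀ a b → (a * x + b * y) + (- (a * x + b * y)) ≡ 0ℤ
    start a b = solve (a ∷ b ∷ x ∷ y ∷ [])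
    advance : ∀ a b → (a * (x + h * e) + b * (y + h * f)) + (- (a * x + b * y)) ≡ h * (a * e + b * f)
    advance a b = solve (a ∷ b ∷ h ∷ e ∷ f ∷ x ∷ y ∷ [])
    orthogonal : h * ((- f) * e + e * f) ≡ 0ℤ
    orthogonal = solve (h ∷ e ∷ f ∷ [])
    φU : ∀ j → act φ (U j) ≡ ((0ℤ , 0ℤ) Vec.∷ (h , 0ℤ) Vec.∷ Vec.[]) j
    φU 0F = cong₂ _,_ (start u v) (start (- f) e)
    φU 1F = cong₂ _,_
      (trans (advance u v) (trans (cong (h *_) uv) (ℤₚ.*-identityʳ h)))
      (trans (advance (- f) e) orthogonal)

  -- Segments, and triangles with a vertex in a corner of the box

  module _ {n h} {V : Vector LatticePoint (suc n)} (0<h : 0ℤ < h) (min : Minimal h V) where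

    private
      0+h*1 : h ≡ 0ℤ + h * 1ℤ
      0+h*1 = solve (h ∷ [])

      z+h*0 : ∀ z → z ≡ z + h * 0ℤ
      z+h*0 z = solve (z ∷ h ∷ [])

      h+h*-1 : 0ℤ ≡ h + h * -1ℤ
      h+h*-1 = solve (h ∷ [])

    horizontal : ∀ {y} → (0ℤ , y) ∈ V → (h , y) ∈ V → Classified h (conv V)
    horizontal {y} X Y = inj₁ (segment-≃ 1ℤ 0ℤ 1ℤ 0ℤ 0<h min X Y 0+h*1 (z+h*0 y) refl)

    vertical : ∀ {x} → (x , 0ℤ) ∈ V → (x , h) ∈ V → Classified h (conv V)
    vertical {x} X Y = inj₁ (segment-≃ 0ℤ 1ℤ 0ℤ 1ℤ 0<h min X Y (z+h*0 x) 0+h*1 refl)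

    antidiagonal : (0ℤ , h) ∈ V → (h , 0ℤ) ∈ V → Classified h (conv V)
    antidiagonal X Y = inj₁ (segment-≃ 1ℤ -1ℤ 1ℤ 0ℤ 0<h min X Y 0+h*1 h+h*-1 refl)

    -- The corner lies on the left and the top side, so three points meet all four sides. If another
    -- of them is a corner too, two of the points span a segment of type (a).
    corner : ∀ {q r} → InBox h V → (0ℤ , h) ∈ V → (h , q) ∈ V → (r , 0ℤ) ∈ V → Classified h (conv V)
    corner {q} {r} box L R S
      with endpoint (proj₂ (box-∈ box R)) | endpoint (proj₁ (box-∈ box S))
    ... | inj₁ refl        | _                = antidiagonal L R
    ... | inj₂ (inj₁ refl) | _                = horizontal L R
    ... | inj₂ (inj₂ _)    | inj₁ refl        = vertical S L
    ... | inj₂ (inj₂ _)    | inj₂ (inj₁ refl) = antidiagonal L S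
    ... | inj₂ (inj₂ q-int) | inj₂ (inj₂ r-int) = inj₂ (inj₁
      (r , h - q , r-int , interior-complement {h} {q} q-int , h≤r+[h-q] ,
        conv-≃ (reflect h) {U = U} U⊆V (least min U U⊆V U-wide) φU))
      where
      U : Vector LatticePoint 3
      U = (0ℤ , h) Vec.∷ (r , 0ℤ) Vec.∷ (h , q) Vec.∷ Vec.[]
      U⊆V : ∀ j → conv V (ι (U j))
      U⊆V 0F = ∈-conv L
      U⊆V 1F = ∈-conv S
      U⊆V 2F = ∈-conv R
      0≤h : 0ℤ ≤ h
      0≤h = ℤₚ.<⇒≤ 0<h
      U-wide : Wide h U
      U-wide = Wide-frame {U = U} (0F , refl) (2F , refl) (1F , refl) (0F , refl)
        (0≤h , ℤₚ.≤-refl) (proj₂ (box-∈ box R)) (proj₁ (box-∈ box S)) (ℤₚ.≤-refl , 0≤h)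
      -- The levels of `(h , q)` and `(r , 0)` differ by at most `h`, that is, q ≤ r.
      h≤r+[h-q] : h ≤ r + (h - q)
      h≤r+[h-q] = ≤-by (Δ (level-bound 0<h min box L R (proj₂ (proj₂ (box-∈ box R))) R S))
        (solve (h ∷ q ∷ r ∷ []))
      φU : ∀ j → act (reflect h) (U j) ≡ ((0ℤ , 0ℤ) Vec.∷ (r , h) Vec.∷ (h , h - q) Vec.∷ Vec.[]) j
      φU 0F = trans (act-reflect h 0ℤ h) (cong (0ℤ ,_) (ℤₚ.+-inverseʳ h))
      φU 1F = trans (act-reflect h r 0ℤ) (cong (r ,_) (ℤₚ.+-identityʳ h))
      φU 2F = act-reflect h h q

  corner′ : ∀ {n h p s} {V : Vector LatticePoint (suc n)} → 0ℤ < h → Minimal h V → InBox h V →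
    (h , 0ℤ) ∈ V → (0ℤ , p) ∈ V → (s , h) ∈ V → Classified h (conv V)
  corner′ {h = h} {p} {s} {V} 0<h min box R L T = Classified-act {V = V} transpose
    (corner 0<h (Minimal-act transpose min) (box-transpose box)
      (∈-act transpose (act-transpose h 0ℤ) R)
      (∈-act transpose (act-transpose s h) T)
      (∈-act transpose (act-transpose 0ℤ p) L))

  ⊓-case : ∀ (P : ℤ → Set) i j → P i → P j → P (i ⊓ j)
  ⊓-case P i j Pi Pj with ℤₚ.⊓-sel i j
  ... | inj₁ eq = subst P (sym eq) Pi
  ... | inj₂ eq = subst P (sym eq) Pj

  -- Polygons that meet all four sides of the box

  module _ {n h} {V : Vector LatticePoint (suc n)} (0<h : 0ℤ < h) (min : Minimal h V) (box : InBox h V) where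

    private
      0≤h : 0ℤ ≤ h
      0≤h = ℤₚ.<⇒≤ 0<h

    module _ {p q r s} (L : (0ℤ , p) ∈ V) (R : (h , q) ∈ V) (S : (r , 0ℤ) ∈ V) (T : (s , h) ∈ V)
      (p-int : Interior h p) (q-int : Interior h q) (r-int : Interior h r) (s-int : Interior h s)
      (q<p : q < p) where

      private
        q≤p : q ≤ p
        q≤p = ℤₚ.<⇒≤ q<p

        p≤q+h : p ≤ q + h
        p≤q+h = ≤-by (proj₁ (proj₂ (box-∈ box R)) ⊕ Δ (proj₂ (proj₂ (box-∈ box L))))
          (solve (p ∷ q ∷ h ∷ []))

        q≤r : q ≤ r
        q≤r = ≤-by (Δ (level-bound 0<h min box L R q≤p R S)) (solve (h ∷ q ∷ r ∷ []))

        s≤p : s ≤ p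
        s≤p = ≤-by (Δ (level-bound 0<h min box L R q≤p T L)) (solve (h ∷ s ∷ p ∷ []))

        s≤r : s ≤ r
        s≤r = ≤-by (Δ (level-bound 0<h min box L R q≤p T S)) (solve (h ∷ s ∷ r ∷ []))

        0*x+1*y : ∀ x y → 0ℤ * x + 1ℤ * y ≡ y
        0*x+1*y x y = solve (x ∷ y ∷ [])

      -- Otherwise (0 , p), (h , q), (r , 0) span a polygon of the same lattice
      -- size that does not reach the height of (s , h).
      q≢r : ¬ q ≡ r
      q≢r refl = absurd (Δ top) (solve (s ∷ h ∷ []))
        where
        U : Vector LatticePoint 3
        U = (0ℤ , p) Vec.∷ (h , q) Vec.∷ (q , 0ℤ) Vec.∷ Vec.[]
        U⊆V : ∀ j → conv V (ι (U j))
        U⊆V 0F = ∈-conv L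
        U⊆V 1F = ∈-conv R
        U⊆V 2F = ∈-conv S
        U-wide : Wide h U
        U-wide = Wide-slanted {U = U} 0≤h (0F , refl) (1F , refl) (1F , refl) (2F , refl) q≤p p≤q+h
          (≤-by ℤₚ.≤-refl (solve (h ∷ q ∷ []))) (≤-by (proj₁ (proj₁ (box-∈ box S))) (solve (h ∷ q ∷ [])))
        below : ∀ x y → y ≤ h - 1ℤ → 1ℤ - h ≤ 0ℤ * x + -1ℤ * y
        below x y y≤h-1 = ≤-by (Δ y≤h-1) (solve (h ∷ x ∷ y ∷ []))
        U-below : ∀ j → 1ℤ - h ≤ 0ℤ * proj₁ (U j) + -1ℤ * proj₂ (U j)
        U-below 0F = below 0ℤ p (proj₂ p-int)
        U-below 1F = below h q (proj₂ q-int)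
        U-below 2F = below q 0ℤ (Δ (ℤₚ.i<j⇒suc[i]≤j 0<h))
        top : 1ℤ - h ≤ 0ℤ * s + -1ℤ * h
        top = conv-bound U 0ℤ -1ℤ (1ℤ - h) U-below (s , h) (least-∈ min U U⊆V U-wide T)

      -- The counterpart at the top: for s = p the levels of `(s , h)` and `(0 , s)` differ by
      -- exactly `h`, so that the points on the left, right and top suffice, and these stay off the
      -- bottom side.
      s≢p : ¬ s ≡ p
      s≢p refl = absurd (Δ bottom) (solve (r ∷ []))
        where
        U : Vector LatticePoint 3
        U = (0ℤ , s) Vec.∷ (h , q) Vec.∷ (s , h) Vec.∷ Vec.[]
        U⊆V : ∀ j → conv V (ι (U j))
        U⊆V 0F = ∈-conv L
        U⊆V 1F = ∈-conv R
        U⊆V 2F = ∈-conv T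
        U-wide : Wide h U
        U-wide = Wide-slanted {U = U} 0≤h (0F , refl) (1F , refl) (2F , refl) (0F , refl) q≤p p≤q+h
          (≤-by ℤₚ.≤-refl (solve (h ∷ s ∷ []))) (≤-by (Δ (proj₂ (proj₁ (box-∈ box T)))) (solve (h ∷ s ∷ [])))
        above : ∀ x y → 1ℤ ≤ y → 1ℤ ≤ 0ℤ * x + 1ℤ * y
        above x y = subst (1ℤ ≤_) (sym (0*x+1*y x y))
        U-above : ∀ j → 1ℤ ≤ 0ℤ * proj₁ (U j) + 1ℤ * proj₂ (U j)
        U-above 0F = above 0ℤ s (proj₁ p-int)
        U-above 1F = above h q (proj₁ q-int)
        U-above 2F = above s h (ℤₚ.i<j⇒suc[i]≤j 0<h)
        bottom : 1ℤ ≤ 0ℤ * r + 1ℤ * 0ℤ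
        bottom = conv-bound U 0ℤ 1ℤ 1ℤ U-above (r , 0ℤ) (least-∈ min U U⊆V U-wide S)

      quadrilateral : Classified h (conv V)
      quadrilateral with s ℤₚ.≟ r
      ... | yes refl = vertical 0<h min S T
      ... | no  s≢r  = inj₂ (inj₂ (r , p , h - q , h - s , r-int , p-int ,
        interior-complement {h} {q} q-int , interior-complement {h} {s} s-int , h<min+min ,
        conv-≃ (affine 1ℤ 0ℤ 0ℤ 1ℤ 0ℤ 0ℤ (inj₁ refl)) {U = U} U⊆V (least min U U⊆V U-wide) fixed))
        where
        U : Vector LatticePoint 4
        U = (r , 0ℤ) Vec.∷ (0ℤ , p) Vec.∷ (h , q) Vec.∷ (s , h) Vec.∷ Vec.[]
        U⊆V : ∀ j → conv V (ι (U j))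
        U⊆V 0F = ∈-conv S
        U⊆V 1F = ∈-conv L
        U⊆V 2F = ∈-conv R
        U⊆V 3F = ∈-conv T
        U-wide : Wide h U
        U-wide = Wide-frame {U = U} (1F , refl) (2F , refl) (0F , refl) (3F , refl)
          (proj₂ (box-∈ box L)) (proj₂ (box-∈ box R)) (proj₁ (box-∈ box S)) (proj₁ (box-∈ box T))
        sum> : ∀ {y z} → y < z → h < z + (h - y)
        sum> {y} {z} y<z = <-by (<⇒Δ y<z) (solve (h ∷ y ∷ z ∷ []))
        -- The minima unfold to the comparisons of q and s with r and p. The bounds on levels give
        -- three of them weakly, and equality is excluded in each case; q < p is given.
        h<min+min : h < (r ⊓ p) + ((h - q) ⊓ (h - s))
        h<min+min = ⊓-case (λ z → h < z + ((h - q) ⊓ (h - s))) r p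
          (⊓-case (λ z → h < r + z) (h - q) (h - s) (sum> (ℤₚ.≤∧≢⇒< q≤r q≢r)) (sum> (ℤₚ.≤∧≢⇒< s≤r s≢r)))
          (⊓-case (λ z → h < p + z) (h - q) (h - s) (sum> q<p) (sum> (ℤₚ.≤∧≢⇒< s≤p s≢p)))
        act-identity : ∀ x y {y′} → y ≡ y′ → ((1ℤ * x + 0ℤ * y) + 0ℤ , (0ℤ * x + 1ℤ * y) + 0ℤ) ≡ (x , y′)
        act-identity x y refl = cong₂ _,_ (solve (x ∷ y ∷ [])) (solve (x ∷ y ∷ []))
        back : ∀ z → z ≡ h - (h - z)
        back z = solve (h ∷ z ∷ [])
        fixed : ∀ j → act (affine 1ℤ 0ℤ 0ℤ 1ℤ 0ℤ 0ℤ (inj₁ refl)) (U j) ≡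
          ((r , 0ℤ) Vec.∷ (0ℤ , p) Vec.∷ (h , h - (h - q)) Vec.∷ (h - (h - s) , h) Vec.∷ Vec.[]) j
        fixed 0F = act-identity r 0ℤ refl
        fixed 1F = act-identity 0ℤ p refl
        fixed 2F = act-identity h q (back q)
        fixed 3F = trans (act-identity s h refl) (cong (_, h) (back s))

    framed : ∀ {p q r s} → (0ℤ , p) ∈ V → (h , q) ∈ V → (r , 0ℤ) ∈ V → (s , h) ∈ V → q ≤ p →
      Classified h (conv V)
    framed {p} {q} {r} {s} L R S T q≤p with q ℤₚ.≟ p
    ... | yes refl = horizontal 0<h min L R
    ... | no  q≢p
      with endpoint (proj₂ (box-∈ box L)) | endpoint (proj₂ (box-∈ box R))
         | endpoint (proj₁ (box-∈ box S)) | endpoint (proj₁ (box-∈ box T))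
    ... | inj₁ refl | _ | _ | _ = ⊥-elim (q≢p (ℤₚ.≤-antisym q≤p (proj₁ (proj₂ (box-∈ box R)))))
    ... | inj₂ (inj₁ refl) | _ | _ | _ = corner 0<h min box L R S
    ... | _ | inj₁ refl | _ | _ = corner′ 0<h min box R L T
    ... | _ | inj₂ (inj₁ refl) | _ | _ = ⊥-elim (q≢p (ℤₚ.≤-antisym q≤p (proj₂ (proj₂ (box-∈ box L)))))
    ... | _ | _ | inj₂ (inj₁ refl) | _ = corner′ 0<h min box S L T
    ... | _ | _ | _ | inj₁ refl = corner 0<h min box T R S
    -- The corners (0, h) and (h, 0) gave triangles or segments. The corners (0, 0) and (h, h), here
    -- and in the next case, would make the levels spread by more than `h`.
    ... | _ | inj₂ (inj₂ (1≤q , _)) | inj₁ refl | _ =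
      absurd (Δ (level-bound 0<h min box L R q≤p R S) ⊕ Δ 1≤q) (solve (h ∷ q ∷ []))
    ... | inj₂ (inj₂ (_ , p≤h-1)) | _ | _ | inj₂ (inj₁ refl) =
      absurd (Δ (level-bound 0<h min box L R q≤p T L) ⊕ Δ p≤h-1) (solve (h ∷ p ∷ []))
    ... | inj₂ (inj₂ p-int) | inj₂ (inj₂ q-int) | inj₂ (inj₂ r-int) | inj₂ (inj₂ s-int) =
      quadrilateral L R S T p-int q-int r-int s-int (ℤₚ.≤∧≢⇒< q≤p q≢p)

  -- Reduction to polygons that meet all four sides

  module _ {h x y x′ y′ : ℤ} (x≤h : x ≤ h) (0≤x′ : 0ℤ ≤ x′) where

    -- No coordinate spreads by more than `h` inside the box, so a spread of `h` is attained only
    -- between opposite sides.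
    x-extremes : h ≤ 1ℤ * (x - x′) + 0ℤ * (y - y′) → x ≡ h × x′ ≡ 0ℤ
    x-extremes wide =
      ℤₚ.≤-antisym x≤h (≤-by (Δ wide ⊕ 0≤x′) (solve (h ∷ x ∷ y ∷ x′ ∷ y′ ∷ []))) ,
      ℤₚ.≤-antisym (≤-by (Δ wide ⊕ Δ x≤h) (solve (h ∷ x ∷ y ∷ x′ ∷ y′ ∷ []))) 0≤x′

    y-extremes : h ≤ 0ℤ * (y - y′) + 1ℤ * (x - x′) → x ≡ h × x′ ≡ 0ℤ
    y-extremes wide = x-extremes (subst (h ≤_) (ℤₚ.+-comm (0ℤ * (y - y′)) (1ℤ * (x - x′))) wide)

  module _ {n h} {V : Vector LatticePoint (suc n)} (0<h : 0ℤ < h) (min : Minimal h V) (box : InBox h V) where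

    -- If the polygon does not span the box vertically, then the levels x + y
    -- have width exactly h on it and may replace the ordinate.
    descending : ∀ {p q} → (0ℤ , p) ∈ V → (h , q) ∈ V → q ≤ p → Classified h (conv V)
    descending {p} {q} L R q≤p with wide min 0ℤ 1ℤ 1ℤ 1ℤ (inj₂ refl)
    ... | inj₁ (spread i j tall) =
      let y≡h , y′≡0 = y-extremes {x = proj₂ (V i)} {proj₁ (V i)} {proj₂ (V j)} {proj₁ (V j)}
                         (proj₂ (proj₂ (box i))) (proj₁ (proj₂ (box j))) tall
      in framed 0<h min box L R (j , cong (proj₁ (V j) ,_) y′≡0) (i , cong (proj₁ (V i) ,_) y≡h) q≤p
    ... | inj₂ (spread i j tall) = Classified-act {V = V} (shear m)
      (framed 0<h (Minimal-act (shear m) min) sheared-box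
        (∈-act {U = V} (shear m) (trans (act-shear m 0ℤ p) (cong (λ z → 0ℤ , m - z) (ℤₚ.+-identityˡ p))) L)
        (∈-act {U = V} (shear m) (act-shear m h q) R)
        (∈-act {U = V} (shear m) (trans (act-shear m a b) (cong (a ,_) (ℤₚ.+-inverseʳ m))) (i , refl))
        (∈-act {U = V} (shear m) (trans (act-shear m c d) (cong (c ,_) full)) (j , refl))
        (ℤₚ.+-monoʳ-≤ m (ℤₚ.neg-mono-≤ p≤h+q)))
      where
      a b c d m : ℤ
      a = proj₁ (V i)
      b = proj₂ (V i)
      c = proj₁ (V j)
      d = proj₂ (V j)
      m = a + b
      level : ∀ k l → (proj₁ (V k) + proj₂ (V k)) - (proj₁ (V l) + proj₂ (V l)) ≤ h
      level k l = level-bound 0<h min box L R q≤p (k , refl) (l , refl)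
      regroup : ∀ a b c d → 1ℤ * (a - c) + 1ℤ * (b - d) ≡ (a + b) - (c + d)
      regroup a b c d = solve (a ∷ b ∷ c ∷ d ∷ [])
      full : m - (c + d) ≡ h
      full = ℤₚ.≤-antisym (level i j) (subst (h ≤_) (regroup a b c d) tall)
      p≤h+q : p ≤ h + q
      p≤h+q = ≤-by (proj₁ (proj₂ (box-∈ box R)) ⊕ Δ (proj₂ (proj₂ (box-∈ box L))))
        (solve (h ∷ p ∷ q ∷ []))
      -- `m` is the largest level: it exceeds the level n = c + d by `h`, and no other level exceeds
      -- n by more.
      nonneg : ∀ l m n → m - n ≡ h → l - n ≤ h → 0ℤ ≤ m - l
      nonneg l m n refl l-n≤h = ≤-by (Δ l-n≤h) (solve (l ∷ m ∷ n ∷ []))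
      sheared-box : InBox h (act (shear m) ∘ V)
      sheared-box = box-act (shear m) (λ (x , y) → x , m - (x + y)) (λ (x , y) → act-shear m x y)
        (λ k → proj₁ (box k) ,
          (nonneg (proj₁ (V k) + proj₂ (V k)) m (c + d) full (level k j) , level i k))

  across : ∀ {n h p q} {V : Vector LatticePoint (suc n)} → 0ℤ < h → Minimal h V → InBox h V →
    (0ℤ , p) ∈ V → (h , q) ∈ V → Classified h (conv V)
  across {h = h} {p} {q} {V} 0<h min box L R with ℤₚ.≤-total q p
  ... | inj₁ q≤p = descending 0<h min box L R q≤p
  ... | inj₂ p≤q = Classified-act {V = V} (reflect h)
    (descending 0<h (Minimal-act (reflect h) min) (box-reflect box)
      (∈-act (reflect h) (act-reflect h 0ℤ p) L) (∈-act (reflect h) (act-reflect h h q) R)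
      (ℤₚ.+-monoʳ-≤ h (ℤₚ.neg-mono-≤ p≤q)))

  classify : ∀ {n h} {V : Vector LatticePoint (suc n)} → 0ℤ < h → Minimal h V → InBox h V →
    Classified h (conv V)
  classify {h = h} {V} 0<h min box with wide min 1ℤ 0ℤ 0ℤ 1ℤ (inj₁ refl)
  ... | inj₁ (spread i j broad) =
    let x≡h , x′≡0 = x-extremes {x = proj₁ (V i)} {proj₂ (V i)} {proj₁ (V j)} {proj₂ (V j)}
                       (proj₂ (proj₁ (box i))) (proj₁ (proj₁ (box j))) broad
    in across {V = V} 0<h min box (j , cong (_, proj₂ (V j)) x′≡0) (i , cong (_, proj₂ (V i)) x≡h)
  ... | inj₂ (spread i j tall) =
    let y≡h , y′≡0 = y-extremes {x = proj₂ (V i)} {proj₁ (V i)} {proj₂ (V j)} {proj₁ (V j)}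
                       (proj₂ (proj₂ (box i))) (proj₁ (proj₂ (box j))) tall
    in Classified-act {V = V} transpose (across 0<h (Minimal-act transpose min) (box-transpose box)
         (∈-act {U = V} transpose (act-transpose (proj₁ (V j)) 0ℤ) (j , cong (proj₁ (V j) ,_) y′≡0))
         (∈-act {U = V} transpose (act-transpose (proj₁ (V i)) h) (i , cong (proj₁ (V i) ,_) y≡h)))

open import Data.Vec.Functional using (_∷_; [])

mainTheorem8 : (h : ℤ) → 1ℤ ≤ h →
    (P : Region) → IsMinimal P (fromℤ h) →
    P ≃ conv ((0ℤ , 0ℤ) ∷ (h , 0ℤ) ∷ [])
    ⊎ (∃[ a ] ∃[ b ]
    (1ℤ ≤ a × a ≤ h - 1ℤ) × (1ℤ ≤ b × b ≤ h - 1ℤ) ×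
    h ≤ a + b ×
    P ≃ conv ((0ℤ , 0ℤ) ∷ (a , h) ∷ (h , b) ∷ []))
    ⊎ (∃[ a ] ∃[ b ] ∃[ c ] ∃[ d ]
    (1ℤ ≤ a × a ≤ h - 1ℤ) × (1ℤ ≤ b × b ≤ h - 1ℤ) ×
    (1ℤ ≤ c × c ≤ h - 1ℤ) × (1ℤ ≤ d × d ≤ h - 1ℤ) ×
    h < (a ⊓ b) + (c ⊓ d) ×
    P ≃ conv ((a , 0ℤ) ∷ (0ℤ , b) ∷ (h , h - c) ∷ (h - d , h) ∷ []))
mainTheorem8 h 1≤h P P-min =
  let n , V , P≐V , V-min , φ , box = IsMinimal⇒Minimal {h} {P} 1≤h P-min
  in Classified-map {P = P} {P′ = conv V} (λ {Q} → ≃-respˡ {P} {conv V} {Q} P≐V)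
       (Classified-act {V = V} φ
         (classify {V = act φ ∘ V} (ℤₚ.suc[i]≤j⇒i<j 1≤h) (Minimal-act φ V-min) box))
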